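{- Let $n,k$ be integers with $1\le k\le \lfloor n/2\rfloor$, and let $\mathcal{O}(n,k)$ be the set of trees of order $n$ having exactly $2k$ odd vertices. If $T\in\mathcal{O}(n,k)$ has minimum Mostar index among all trees in $\mathcal{O}(n,k)$, then $T\cong C_{n,\lceil\frac{k-1}{2}\rceil,\lfloor\frac{k-1}{2}\rfloor}$.
   Context: For a connected simple graph $G$, the Mostar index is $Mo(G)=\sum_{uv\in E(G)}|n_u-n_v|$, where for an edge $e=uv$, $n_u$ is the number of vertices of $G$ closer (in graph distance) to $u$ than to $v$, and $n_v$ is the number of vertices closer to $v$ than to $u$. The order of a graph is its number of vertices. A vertex is odd if its degree is odd. For integers $a,b\ge 0$ with $2(a+b)\le n-1$, $C_{n,a,b}$ is the tree obtained from the path $P_{n-a-b}=v_1v_2\dots v_{n-a-b}$ by attaching a pendent vertex $u_i$ to $v_i$ for each $i$ with $2\le i\le a+1$ and each $i$ with $n-a-2b\le i\le n-a-b-1$. In particular $C_{n,0,0}=P_n$, the path on $n$ vertices. -}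

module Defs where

open import Data.Fin using (Fin; zero; suc; toℕ; fromℕ; inject₁)
import Data.Fin as Fin
import Data.Fin.Properties as Fin
open import Data.List using (List; length; filter; map; allFin; cartesianProduct)
open import Data.Nat
open import Data.Nat.DivMod using (_%_)
open import Data.Nat.ListAction using (sum)
open import Data.Nat.Properties
open import Data.Product using (Σ; ∃; _×_; _,_; proj₁)
open import Data.Sum using (_⊎_; inj₁; inj₂; swap)
open import Function.Bundles using (_⤖_; _⇔_; Bijection)
open import Function.Definitions using (Injective)
open import Level using (0ℓ)
open import Relation.Binary using (Rel; Symmetric; Irreflexive; Decidable)
open import Relation.Binary.PropositionalEquality using (_≡_; refl)
open import Relation.Nullary using (¬_; Dec; yes; no)
open import Relation.Nullary.Decidable using (_×-dec_; _⊎-dec_)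
open import Relation.Nullary.Negation using (contradiction)
import Relation.Unary as U

record SimpleGraph (n : ℕ) : Set₁ where
  field
    Adj        : Rel (Fin n) 0ℓ
    adj?       : Decidable Adj
    adj-sym    : Symmetric Adj
    adj-irrefl : Irreflexive _≡_ Adj

open SimpleGraph public

_≅_ : ∀ {n} → SimpleGraph n → SimpleGraph n → Set
_≅_ {n} G H = Σ (Fin n ⤖ Fin n) λ f →
  ∀ u v → Adj G u v ⇔ Adj H (Bijection.to f u) (Bijection.to f v)

count : ∀ {n} {P : U.Pred (Fin n) 0ℓ} → U.Decidable P → ℕ
count {n} P? = length (filter P? (allFin n))

least : {P : U.Pred ℕ 0ℓ} → U.Decidable P → ∀ k → P k →
        ∃ λ d → P d × (∀ e → P e → d ≤ e)
least P? zero p = zero , p , λ _ _ → z≤n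
least {P} P? (suc k) p with P? 0
... | yes p₀ = zero , p₀ , λ _ _ → z≤n
... | no ¬p₀ with least {λ j → P (suc j)} (λ j → P? (suc j)) k p
...   | d , q , min = suc d , q , min′
  where
  min′ : ∀ e → P e → suc d ≤ e
  min′ zero    r = contradiction r ¬p₀
  min′ (suc e) r = s≤s (min e r)

module _ {n : ℕ} (G : SimpleGraph n) where

  Walk : ℕ → Fin n → Fin n → Set
  Walk zero    u v = u ≡ v
  Walk (suc ℓ) u v = ∃ λ w → Adj G u w × Walk ℓ w v

  walk? : ∀ ℓ u v → Dec (Walk ℓ u v)
  walk? zero    u v = u Fin.≟ v
  walk? (suc ℓ) u v = Fin.any? λ w → adj? G u w ×-dec walk? ℓ w v

  Connected : Set
  Connected = ∀ u v → ∃ λ ℓ → Walk ℓ u v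

  -- A cycle of length 3 + excess.
  record Cycle : Set where
    field
      excess   : ℕ
      vertex   : Fin (3 + excess) → Fin n
      distinct : Injective _≡_ _≡_ vertex
      steps    : ∀ i → Adj G (vertex (inject₁ i)) (vertex (suc i))
      closing  : Adj G (vertex (fromℕ (2 + excess))) (vertex zero)

  record IsTree : Set where
    field
      connected : Connected
      acyclic   : ¬ Cycle

  degree : Fin n → ℕ
  degree v = count (adj? G v)

  OddVertex : Fin n → Set
  OddVertex v = degree v % 2 ≡ 1

  oddVertex? : U.Decidable OddVertex
  oddVertex? v = degree v % 2 ≟ 1

  Edge : Fin n × Fin n → Set
  Edge (u , v) = (u Fin.< v) × Adj G u v

  edge? : U.Decidable Edge
  edge? (u , v) = (u Fin.<? v) ×-dec adj? G u v

  edges : List (Fin n × Fin n)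
  edges = filter edge? (cartesianProduct (allFin n) (allFin n))

  module _ (conn : Connected) where

    -- conn only bounds the search: the value does not depend on it.
    dist : Fin n → Fin n → ℕ
    dist u v = let (ℓ , w) = conn u v in
      proj₁ (least {λ j → Walk j u v} (λ j → walk? j u v) ℓ w)

    closer : Fin n → Fin n → ℕ
    closer u v = count (λ w → dist w u <? dist w v)

    Mo : ℕ
    Mo = sum (map (λ (u , v) → ∣ closer u v - closer v u ∣) edges)

record 𝒪 (n k : ℕ) (T : SimpleGraph n) : Set where
  field
    isTree  : IsTree T
    oddness : count (oddVertex? T) ≡ 2 * k

  open IsTree isTree public

-- The vertices of C n a b are numbered from 0: first the path, with v_i at
-- position i ∸ 1; then the a vertices u_2, …, u_{a+1}; then the b vertices
-- u_{n-a-2b}, …, u_{n-a-b-1}.  The definition is meaningful when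
-- 2 (a + b) ≤ n - 1.
module _ (n a b : ℕ) where

  spine : ℕ
  spine = n ∸ (a + b)

  -- Each edge is listed once, from its smaller to its larger endpoint.
  -- * y = spine + (i ∸ 2) is u_i for 2 ≤ i ≤ a + 1, and x = i ∸ 1 is v_i.
  -- * y = spine + a + (i ∸ (spine ∸ b)) is u_i for spine ∸ b ≤ i ≤ spine ∸ 1,
  --   and x = i ∸ 1 is v_i, so y = a + b + i = a + b + 1 + x.
  PathEdge LeftPendent RightPendent CEdge : ℕ → ℕ → Set
  PathEdge     x y = suc x ≡ y × y < spine
  LeftPendent  x y = x < spine × spine ≤ y × y < spine + a × x + spine ≡ suc y
  RightPendent x y = x < spine × spine + a ≤ y × a + b + suc x ≡ y
  CEdge        x y = PathEdge x y ⊎ LeftPendent x y ⊎ RightPendent x y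

  cedge? : Decidable CEdge
  cedge? x y =
    ((suc x ≟ y) ×-dec (y <? spine))
    ⊎-dec ((x <? spine) ×-dec (spine ≤? y) ×-dec (y <? spine + a) ×-dec (x + spine ≟ suc y))
    ⊎-dec ((x <? spine) ×-dec (spine + a ≤? y) ×-dec (a + b + suc x ≟ y))

  cedge-< : ∀ {x y} → CEdge x y → x < y
  cedge-< (inj₁ (refl , _))                   = ≤-refl
  cedge-< (inj₂ (inj₁ (x<s , s≤y , _)))       = <-≤-trans x<s s≤y
  cedge-< (inj₂ (inj₂ (x<s , s+a≤y , _)))     = <-≤-trans x<s (m+n≤o⇒m≤o spine s+a≤y)

  C : SimpleGraph n
  C = record
    { Adj        = λ x y → CEdge (toℕ x) (toℕ y) ⊎ CEdge (toℕ y) (toℕ x)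
    ; adj?       = λ x y → cedge? (toℕ x) (toℕ y) ⊎-dec cedge? (toℕ y) (toℕ x)
    ; adj-sym    = swap
    ; adj-irrefl = λ { refl (inj₁ e) → <-irrefl refl (cedge-< e)
                     ; refl (inj₂ e) → <-irrefl refl (cedge-< e) }
    }

{-# OPTIONS --safe #-}
-- Split a tree of order n at a vertex c into two subtrees X and Y that share only c.
-- An edge with s vertices on the side away from c contributes at least n − 2s to the
-- Mostar index, with equality if 2s ≤ n, and these numbers s add up to the sum of the
-- distances to c.  Hence Mo ≥ n(n − 1) − 2(depths X + depths Y), with equality if X and
-- Y have at most n/2 vertices besides c.
--
-- Let X have x vertices besides c and let 2i + 1 of its vertices be odd when c gets one
-- further neighbour; define y and j likewise for Y.  By induction on X,
-- 2 depths X ≤ x(x + 1) − 2i², with equality only for a path from c that ends in a comb,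
-- and counting parities at c gives i + j ≥ k − 1.
--
-- Moving branches between X and Y, or c itself towards the heavier side, one reaches
-- |x − y| ≤ 1, unless the heavier side has two branches with at least |x − y| ≥ 2
-- vertices each; then the loss in the induction step where they are joined contradicts
-- minimality.  If |x − y| ≤ 1, minimality forces {i, j} = {⌈(k − 1)/2⌉, ⌊(k − 1)/2⌋} and
-- equality in both inductions, and c can be slid along the path to a standard position.

module Submission where

open import Defs
open import Data.Nat using (ℕ; _≤_; _∸_; ⌊_/2⌋; ⌈_/2⌉)
import Algebra.Solver.CommutativeMonoid as CommutativeMonoidSolver
open import Data.Bool using (Bool; true; false; not; _∨_; _xor_)
import Data.Bool as Bool
open import Data.Bool.Properties using (not-injective; ¬-not; not-distribˡ-xor; ∨-zeroʳ)
open import Data.Empty using (⊥)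
open import Data.Fin using (Fin; zero; suc; toℕ; fromℕ; inject₁; #_)
import Data.Fin as Fin
open import Data.Fin.Induction using (<-weakInduction)
import Data.Fin.Properties as Fin
open import Data.List using
  (List; []; _∷_; _++_; allFin; length; map; filter; cartesianProduct; lookup; tabulate)
open import Data.List.Properties using
  (++-identityʳ; ++-assoc; length-++; length-tabulate; length-map; map-++; map-∘; map-cong;
   filter-++; filter-accept; filter-reject; ∷-injective; tabulate-cong)
import Data.List.Membership.DecPropositional as DecMembership
open import Data.List.Membership.Propositional using (_∈_; _∉_)
open import Data.List.Membership.Propositional.Properties using
  (∈-++⁺ˡ; ∈-++⁺ʳ; ∈-++⁻; ∈-filter⁺; ∈-filter⁻; ∈-allFin; ∈-map⁺; ∈-map⁻; ∈-lookup;
   ∈-cartesianProduct⁺)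
open import Data.List.Membership.Propositional.Properties.WithK using (unique∧set⇒bag)
open import Data.List.Relation.Binary.BagAndSetEquality using (∼bag⇒↭)
open import Data.List.Relation.Binary.Disjoint.Propositional using (Disjoint)
open import Data.List.Relation.Binary.Permutation.Propositional using
  (_↭_; prep; ↭-refl; ↭-sym; ↭-trans; ↭-reflexive; ↭-swap; ↭⇒↭ₛ)
open import Data.List.Relation.Binary.Permutation.Propositional.Properties using
  (++⁺; ++⁺ˡ; ++⁺ʳ; shift; shifts; ++-comm; ++-commutativeMonoid; ∈-resp-↭; ↭-length; filter-↭)
  renaming (map⁺ to ↭-map⁺)
import Data.List.Relation.Binary.Permutation.Setoid.Properties as PermSetoid
open import Data.List.Relation.Binary.Subset.Propositional using (_⊆_)
open import Data.List.Relation.Unary.All using (All; []; _∷_)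
import Data.List.Relation.Unary.All as All
import Data.List.Relation.Unary.All.Properties as All
open import Data.List.Relation.Unary.AllPairs using ([]; _∷_)
open import Data.List.Relation.Unary.Any using (here; there)
open import Data.List.Relation.Unary.Unique.Propositional using (Unique)
import Data.List.Relation.Unary.Unique.Propositional.Properties as Unique
open import Data.Nat
open import Data.Nat.DivMod using (_%_; _mod_; m<n⇒m%n≡m; m%n<n)
open import Data.Nat.ListAction using (sum)
open import Data.Nat.ListAction.Properties using (sum-++; sum-↭)
open import Data.Nat.Properties
open import Data.Nat.Tactic.RingSolver using (solve-∀)
open import Data.Product using (∃; ∃₂; _×_; _,_; proj₁; proj₂)
import Data.Product as Product
open import Data.Sum using (_⊎_; inj₁; inj₂; [_,_]′)
import Data.Vec as Vec
open import Function.Base using (_∘_)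
open import Function.Bundles using (_⇔_; mk⇔; mk⤖; Equivalence)
open import Level using (0ℓ)
open import Relation.Binary.Definitions using (tri<; tri≈; tri>)
open import Relation.Binary.PropositionalEquality
open import Relation.Nullary using (¬_; yes; no; ¬?; contradiction)
open import Relation.Nullary.Decidable using (decidable-stable)
import Relation.Unary as U

-- Minimality enters only through the comparison with `C n a b`, but the lower bound for `Mo` holds
-- at every split of the tree, balanced or not. So at each of its splits a minimal tree is at least
-- as deep as `C n a b` is at a balanced split. For x = y + g one has 2x(x + 1) + 2y(y + 1) = (x +
-- y)² + 2(x + y) + g², and the comparison becomes i² + j² + losses ≤ a² + b² + g²/4, where a and b
-- are the halves of k - 1. The obstacle is the term g²/4, which integrality removes only if g ≤ 1;
-- hence the search for a balanced split. Where the search is stuck, the loss at the root is to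
-- exceed g²/4. This can fail for one set of parameters with g = 3, where the squares themselves are
-- too unequal. The condition 2k ≤ n means that the path between the two combs of `C n a b` has at
-- least one edge. It is needed for the number of odd vertices of `C n a b`, and also for balancing
-- it when a = b + 1, since one comb then has two vertices more than the other.

infixr 5 _▷_

-- The vertices of a tree are its leaves and its edges are its inner nodes: Y ▷ Z makes
-- root Y a further child of root Z.
data Tree (V : Set) : Set where
  leaf : V → Tree V
  _▷_  : Tree V → Tree V → Tree V

⟦_⟧ : Bool → ℕ
⟦ false ⟧ = 0
⟦ true ⟧  = 1

-- slack b i e j f is p z − ((i + j + ⟦ b ⟧)² − i² − j²) for p = 2 i + 1 + e and
-- z = 2 j + ⟦ b ⟧ + f, with the subtraction carried out.
slack : Bool → ℕ → ℕ → ℕ → ℕ → ℕ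
slack false i e j f = 2 * (i * j) + 2 * (i * f) + 2 * j + f + 2 * (e * j) + e * f
slack true  i e j f = 2 * (i * j) + (2 * i + 1) * f + e * (2 * j + 1) + e * f

slack-product : ∀ b i e j f → (2 * i + 1 + e) * (2 * j + ⟦ b ⟧ + f) ≡
  slack b i e j f + 2 * (i * j) + 2 * ((i + j) * ⟦ b ⟧) + ⟦ b ⟧ * ⟦ b ⟧
slack-product false = lem
  where
  lem : ∀ i e j f → (2 * i + 1 + e) * (2 * j + 0 + f) ≡
    2 * (i * j) + 2 * (i * f) + 2 * j + f + 2 * (e * j) + e * f
      + 2 * (i * j) + 2 * ((i + j) * 0) + 0
  lem = solve-∀
slack-product true = lem
  where
  lem : ∀ i e j f → (2 * i + 1 + e) * (2 * j + 1 + f) ≡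
    2 * (i * j) + (2 * i + 1) * f + e * (2 * j + 1) + e * f
      + 2 * (i * j) + 2 * ((i + j) * 1) + 1
  lem = solve-∀

-- Invariants of rooted trees and the depth formula

module _ {V : Set} where

  root : Tree V → V
  root (leaf v) = v
  root (Y ▷ Z)  = root Z

  descendants : Tree V → ℕ
  descendants (leaf v) = 0
  descendants (Y ▷ Z)  = suc (descendants Y) + descendants Z

  depths : Tree V → ℕ
  depths (leaf v) = 0
  depths (Y ▷ Z)  = suc (descendants Y) + (depths Y + depths Z)

  -- Whether the root has an odd number of children.
  odd : Tree V → Bool
  odd (leaf v) = false
  odd (Y ▷ Z)  = not (odd Z)

  -- If root t gets a parent, then 2 * twigs t + 1 vertices of t have odd degree and
  -- evens t + ⟦ odd t ⟧ have even degree.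
  twigs : Tree V → ℕ
  twigs (leaf v) = 0
  twigs (Y ▷ Z)  = twigs Y + twigs Z + ⟦ odd Z ⟧

  evens : Tree V → ℕ
  evens (leaf v) = 0
  evens (Y ▷ Z)  = (evens Y + ⟦ odd Y ⟧) + evens Z

  -- The root counts among the vertices of `Y`, which receives a parent, but not among the
  -- descendants in `Z`. With these arguments the p and z of `slack` are the number of vertices of
  -- `Y` and `descendants Z`; see `branch-size` and `descendants-twigs`.
  graftSlack : Tree V → Tree V → ℕ
  graftSlack Y Z = slack (odd Z) (twigs Y) (evens Y + ⟦ odd Y ⟧) (twigs Z) (evens Z)

  defect : Tree V → ℕ
  defect (leaf v) = 0
  defect (Y ▷ Z)  = defect Y + defect Z + graftSlack Y Z

  descendants-twigs : ∀ t → descendants t ≡ 2 * twigs t + ⟦ odd t ⟧ + evens t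
  descendants-twigs (leaf v) = refl
  descendants-twigs (Y ▷ Z)
    rewrite descendants-twigs Y | descendants-twigs Z with odd Z
  ... | false = lem (twigs Y) (twigs Z) (evens Y) (evens Z) ⟦ odd Y ⟧
    where
    lem : ∀ i j e f o → suc (2 * i + o + e) + (2 * j + 0 + f) ≡
                        2 * (i + j + 0) + 1 + ((e + o) + f)
    lem = solve-∀
  ... | true = lem (twigs Y) (twigs Z) (evens Y) (evens Z) ⟦ odd Y ⟧
    where
    lem : ∀ i j e f o → suc (2 * i + o + e) + (2 * j + 1 + f) ≡
                        2 * (i + j + 1) + 0 + ((e + o) + f)
    lem = solve-∀

  branch-size : ∀ t → suc (descendants t) ≡ 2 * twigs t + 1 + (evens t + ⟦ odd t ⟧)
  branch-size t rewrite descendants-twigs t = lem (twigs t) (evens t) ⟦ odd t ⟧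
    where
    lem : ∀ i e o → suc (2 * i + o + e) ≡ 2 * i + 1 + (e + o)
    lem = solve-∀

  -- For `Y ▷ Z` the half of the left side grows, beyond the shares of `Y` and `Z`, by
  -- `suc y * z + suc y`. The term `suc y` is the new depth, and `graftSlack` is by design what
  -- `suc y * z` leaves after the growth of the squared twigs. As `defect` is a natural number, this
  -- is the upper bound for depths together with its exact loss.
  depths-defect : ∀ t → descendants t * suc (descendants t) ≡
                        2 * (depths t + twigs t * twigs t + defect t)
  depths-defect (leaf v) = refl
  depths-defect (Y ▷ Z) = begin
      (suc y + z) * suc (suc y + z)
    ≡⟨ expand y z ⟩
      y * suc y + z * suc z + 2 * (suc y * z + suc y)
    ≡⟨ cong₂ (λ u w → u + w + 2 * (suc y * z + suc y)) (depths-defect Y) (depths-defect Z) ⟩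
      2 * (DY + i * i + εY) + 2 * (DZ + j * j + εZ) + 2 * (suc y * z + suc y)
    ≡⟨ cong (λ u → 2 * (DY + i * i + εY) + 2 * (DZ + j * j + εZ) + 2 * (u + suc y)) product ⟩
      2 * (DY + i * i + εY) + 2 * (DZ + j * j + εZ) +
        2 * (graftSlack Y Z + 2 * (i * j) + 2 * ((i + j) * o) + o * o + suc y)
    ≡⟨ collect y i j o DY DZ εY εZ (graftSlack Y Z) ⟩
      2 * ((suc y + (DY + DZ)) + (i + j + o) * (i + j + o) + (εY + εZ + graftSlack Y Z)) ∎
    where
    open ≡-Reasoning
    y = descendants Y
    z = descendants Z
    i = twigs Y
    j = twigs Z
    o = ⟦ odd Z ⟧
    DY = depths Y
    DZ = depths Z
    εY = defect Y
    εZ = defect Z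
    expand : ∀ y z → (suc y + z) * suc (suc y + z) ≡
                     y * suc y + z * suc z + 2 * (suc y * z + suc y)
    expand = solve-∀
    collect : ∀ y i j o a b c d s →
      2 * (a + i * i + c) + 2 * (b + j * j + d) +
        2 * (s + 2 * (i * j) + 2 * ((i + j) * o) + o * o + suc y) ≡
      2 * ((suc y + (a + b)) + (i + j + o) * (i + j + o) + (c + d + s))
    collect = solve-∀
    product : suc y * z ≡ graftSlack Y Z + 2 * (i * j) + 2 * ((i + j) * o) + o * o
    product = trans (cong₂ _*_ (branch-size Y) (descendants-twigs Z))
      (slack-product (odd Z) i (evens Y + ⟦ odd Y ⟧) j (evens Z))

-- Trees without loss: combs and caterpillars

module _ {V : Set} where

  below : Tree V → List V
  below (leaf v) = []
  below (Y ▷ Z)  = (root Y ∷ below Y) ++ below Z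

  vertices : Tree V → List V
  vertices t = root t ∷ below t

  arcs : Tree V → List (V × V)
  arcs (leaf v) = []
  arcs (Y ▷ Z)  = ((root Y , root Z) ∷ (root Z , root Y) ∷ arcs Y) ++ arcs Z

  -- Coarse enough to permute the children of a vertex, fine enough to preserve splits.
  record _≈_ (s t : Tree V) : Set where
    constructor mk≈
    field
      root≡  : root s ≡ root t
      below↭ : below s ↭ below t
      arcs↭  : arcs s ↭ arcs t
  open _≈_ public

  ≈-refl : ∀ {t} → t ≈ t
  ≈-refl = mk≈ refl ↭-refl ↭-refl

  ≈-trans : ∀ {r s t} → r ≈ s → s ≈ t → r ≈ t
  ≈-trans (mk≈ p b a) (mk≈ p′ b′ a′) = mk≈ (trans p p′) (↭-trans b b′) (↭-trans a a′)

  ▷-cong : ∀ {Y Y′ Z Z′} → Y ≈ Y′ → Z ≈ Z′ → (Y ▷ Z) ≈ (Y′ ▷ Z′)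
  ▷-cong {Y} {Y′} {Z} {Z′} (mk≈ p b a) (mk≈ p′ b′ a′) = mk≈ p′
    (++⁺ (subst (λ v → root Y ∷ below Y ↭ v ∷ below Y′) p (prep _ b)) b′)
    (++⁺ (subst₂ (λ v w → (root Y , root Z) ∷ (root Z , root Y) ∷ arcs Y ↭
                          (v , w) ∷ (w , v) ∷ arcs Y′) p p′ (prep _ (prep _ a))) a′)

  ▷-swap : ∀ Y Y′ Z → (Y ▷ Y′ ▷ Z) ≈ (Y′ ▷ Y ▷ Z)
  ▷-swap Y Y′ Z = mk≈ refl
    (shifts (vertices Y) (vertices Y′))
    (shifts ((root Y , root Z) ∷ (root Z , root Y) ∷ arcs Y)
            ((root Y′ , root Z) ∷ (root Z , root Y′) ∷ arcs Y′))

  data Comb : ℕ → Tree V → Set where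
    tip   : ∀ {v} → Comb 0 (leaf v)
    tooth : ∀ {q F u v} → Comb q F → Comb (suc q) (leaf u ▷ F ▷ leaf v)

  data Caterpillar : ℕ → ℕ → Tree V → Set where
    comb : ∀ {q F} → Comb q F → Caterpillar 0 q F
    stem : ∀ {j q F v} → Caterpillar j q F → Caterpillar (suc j) q (F ▷ leaf v)

  descendants≡0 : (t : Tree V) → descendants t ≡ 0 → ∃ λ v → t ≡ leaf v
  descendants≡0 (leaf v) _ = v , refl

  singleton : (t : Tree V) → twigs t ≡ 0 → evens t + ⟦ odd t ⟧ ≡ 0 → ∃ λ v → t ≡ leaf v
  singleton t q e = descendants≡0 t (suc-injective (begin
    suc (descendants t)                     ≡⟨ branch-size t ⟩
    2 * twigs t + 1 + (evens t + ⟦ odd t ⟧) ≡⟨ cong₂ (λ i j → 2 * i + 1 + j) q e ⟩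
    1                                       ∎))
    where open ≡-Reasoning

  slack-false≡0 : ∀ i e j f → slack false i e j f ≡ 0 → j ≡ 0 × f ≡ 0
  slack-false≡0 i e zero zero _ = refl , refl
  slack-false≡0 i e zero (suc f) eq =
    contradiction (trans (sym (lem i e f)) eq) λ ()
    where
    lem : ∀ i e f → 2 * (i * 0) + 2 * (i * suc f) + 2 * 0 + suc f + 2 * (e * 0) + e * suc f
      ≡ suc (2 * (i * suc f) + f + e * suc f)
    lem = solve-∀
  slack-false≡0 i e (suc j) f eq =
    contradiction (trans (sym (lem i e j f)) eq) λ ()
    where
    lem : ∀ i e j f →
      2 * (i * suc j) + 2 * (i * f) + 2 * suc j + f + 2 * (e * suc j) + e * f ≡
      suc (2 * (i * suc j) + 2 * (i * f) + (2 * j + 1) + f + 2 * (e * suc j) + e * f)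
    lem = solve-∀

  slack-true≡0 : ∀ i e j f → slack true i e j f ≡ 0 → e ≡ 0 × f ≡ 0 × (i ≡ 0 ⊎ j ≡ 0)
  slack-true≡0 zero    zero j       zero _ = refl , refl , inj₁ refl
  slack-true≡0 (suc i) zero zero    zero _ = refl , refl , inj₂ refl
  slack-true≡0 i (suc e) j f eq =
    contradiction (trans (sym (lem i e j f)) eq) λ ()
    where
    lem : ∀ i e j f →
      2 * (i * j) + (2 * i + 1) * f + suc e * (2 * j + 1) + suc e * f ≡
      suc (2 * (i * j) + (2 * i + 1) * f + (2 * j + e * (2 * j + 1)) + suc e * f)
    lem = solve-∀
  slack-true≡0 i zero j (suc f) eq =
    contradiction (trans (sym (lem i j f)) eq) λ ()
    where
    lem : ∀ i j f →
      2 * (i * j) + (2 * i + 1) * suc f + 0 + 0 ≡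
      suc (2 * (i * j) + (2 * i * suc f + f))
    lem = solve-∀

  evenly-grafted : (Y Z : Tree V) → graftSlack Y Z ≡ 0 → odd Z ≡ false → ∃ λ v → Z ≡ leaf v
  evenly-grafted Y Z eq o rewrite o =
    let j≡0 , f≡0 = slack-false≡0 (twigs Y) (evens Y + ⟦ odd Y ⟧) (twigs Z) (evens Z) eq in
    singleton Z j≡0 (trans (cong₂ _+_ f≡0 (cong ⟦_⟧ o)) refl)

  defect-▷ : (Y Z : Tree V) → defect (Y ▷ Z) ≡ 0 →
             defect Y ≡ 0 × defect Z ≡ 0 × graftSlack Y Z ≡ 0
  defect-▷ Y Z eq =
    m+n≡0⇒m≡0 (defect Y) YZ , m+n≡0⇒n≡0 (defect Y) YZ , m+n≡0⇒n≡0 (defect Y + defect Z) eq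
    where YZ = m+n≡0⇒m≡0 (defect Y + defect Z) eq

  odd≡false : (t : Tree V) → evens t + ⟦ odd t ⟧ ≡ 0 → odd t ≡ false
  odd≡false t eq with odd t | m+n≡0⇒n≡0 (evens t) eq
  ... | false | _ = refl

  -- Without even vertices the root has an even number of children, and `evenly-grafted` leaves at
  -- most two. By `slack-true≡0` one of the two branches has no twigs; having no even vertices
  -- either, it is a leaf and serves as the tooth. Which of the two it is decides whether the
  -- children must be swapped.
  defect≡0⇒comb : (t : Tree V) → defect t ≡ 0 → evens t + ⟦ odd t ⟧ ≡ 0 →
                  ∃ λ t′ → t ≈ t′ × Comb (twigs t) t′
  defect≡0⇒comb (leaf v) _ _ = leaf v , ≈-refl , tip
  defect≡0⇒comb (Y ▷ leaf v) _ e
    with () ← m+n≡0⇒n≡0 (evens Y + ⟦ odd Y ⟧ + 0) e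
  defect≡0⇒comb (Y ▷ Y′ ▷ Z′) d e
    with Yd , Zd , s ← defect-▷ Y (Y′ ▷ Z′) d
    with Y′d , _ , s′ ← defect-▷ Y′ Z′ Zd
    with evenly-grafted Y′ Z′ s′
           (not-injective {odd Z′} {false}
             (not-injective {not (odd Z′)} {true} (odd≡false (Y ▷ Y′ ▷ Z′) e)))
  ... | v , refl
    with slack-true≡0 (twigs Y) _ (twigs Y′ + 0 + 0) _ s
  ... | Ye , Ze , inj₁ Yq
    with u , refl ← singleton Y Yq Ye
    with F , Y′≈F , c ← defect≡0⇒comb Y′ Y′d (m+n≡0⇒m≡0 _ Ze)
    = leaf u ▷ F ▷ leaf v , ▷-cong ≈-refl (▷-cong Y′≈F ≈-refl) ,
      subst (λ q → Comb q (leaf u ▷ F ▷ leaf v)) (lem (twigs Y′)) (tooth c)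
    where
    lem : ∀ q → suc q ≡ (q + 0 + 0) + 1
    lem = solve-∀
  ... | Ye , Ze , inj₂ Zq
    with u , refl ← singleton Y′ (m+n≡0⇒m≡0 _ (m+n≡0⇒m≡0 _ Zq)) (m+n≡0⇒m≡0 _ Ze)
    with F , Y≈F , c ← defect≡0⇒comb Y Yd Ye
    = leaf u ▷ F ▷ leaf v ,
      ≈-trans (▷-swap Y (leaf u) (leaf v)) (▷-cong ≈-refl (▷-cong Y≈F ≈-refl)) ,
      subst (λ q → Comb q (leaf u ▷ F ▷ leaf v)) (lem (twigs Y)) (tooth c)
    where
    lem : ∀ q → suc q ≡ q + 0 + 1
    lem = solve-∀

  -- A root with a single child prolongs the stem. At the first root with more children,
  -- `slack-true≡0` excludes even vertices from there on, and what remains is a comb.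
  defect≡0⇒caterpillar : (t : Tree V) → defect t ≡ 0 →
    ∃₂ λ j t′ → t ≈ t′ × Caterpillar j (twigs t) t′
  defect≡0⇒caterpillar (leaf v) _ = 0 , leaf v , ≈-refl , comb tip
  defect≡0⇒caterpillar (Y ▷ Z) d
    with Yd , Zd , s ← defect-▷ Y Z d
    with odd Z Bool.≟ false
  ... | yes o
    with v , refl ← evenly-grafted Y Z s o
    with j , Y′ , Y≈Y′ , c ← defect≡0⇒caterpillar Y Yd
    = suc j , Y′ ▷ leaf v , ▷-cong Y≈Y′ ≈-refl ,
      subst (λ q → Caterpillar (suc j) q (Y′ ▷ leaf v)) (lem (twigs Y)) (stem c)
    where
    lem : ∀ q → q ≡ q + 0 + 0
    lem = solve-∀
  ... | no ¬o
    with o ← ¬-not ¬o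
    with Ye , Ze , _ ← slack-true≡0 (twigs Y) _ (twigs Z) _
           (trans (cong (λ b → slack b (twigs Y) _ (twigs Z) (evens Z)) (sym o)) s)
    with t′ , t≈t′ , c ← defect≡0⇒comb (Y ▷ Z) d
           (cong₂ _+_ (cong₂ _+_ Ye Ze) (cong (λ b → ⟦ not b ⟧) o))
    = 0 , t′ , t≈t′ , comb c

  comb-twigs : ∀ {q F} → Comb q F → twigs F ≡ q
  comb-twigs tip = refl
  comb-twigs (tooth {F = F} c) rewrite comb-twigs c = lem _
    where
    lem : ∀ q → q + 0 + 0 + 1 ≡ suc q
    lem = solve-∀

  comb-descendants : ∀ {q F} → Comb q F → descendants F ≡ 2 * q
  comb-descendants tip = refl
  comb-descendants (tooth c) rewrite comb-descendants c = lem _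
    where
    lem : ∀ q → suc (suc (2 * q) + 0) ≡ 2 * suc q
    lem = solve-∀

  comb-depths : ∀ {q F} → Comb q F → depths F ≡ q * suc q
  comb-depths tip = refl
  comb-depths (tooth {q} c) rewrite comb-descendants c | comb-depths c = lem q
    where
    lem : ∀ q → suc (suc (2 * q) + (q * suc q + 0)) ≡ suc q * suc (suc q)
    lem = solve-∀

  caterpillar-twigs : ∀ {j q t} → Caterpillar j q t → twigs t ≡ q
  caterpillar-twigs (comb c) = comb-twigs c
  caterpillar-twigs (stem c) rewrite caterpillar-twigs c = lem _
    where
    lem : ∀ q → q + 0 + 0 ≡ q
    lem = solve-∀

  caterpillar-descendants : ∀ {j q t} → Caterpillar j q t → descendants t ≡ 2 * q + j
  caterpillar-descendants (comb c) rewrite comb-descendants c = sym (+-identityʳ _)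
  caterpillar-descendants {suc j} {q} (stem c) rewrite caterpillar-descendants c = lem q j
    where
    lem : ∀ q j → suc (2 * q + j) + 0 ≡ 2 * q + suc j
    lem = solve-∀

  -- Equality in the depth bound; it supplies the depths of `C n a b` for the comparison.
  caterpillar-depths : ∀ {j q t} → Caterpillar j q t →
    2 * (depths t + q * q) ≡ descendants t * suc (descendants t)
  caterpillar-depths {q = q} (comb c) rewrite comb-depths c | comb-descendants c = lem q
    where
    lem : ∀ q → 2 * (q * suc q + q * q) ≡ (2 * q) * suc (2 * q)
    lem = solve-∀
  caterpillar-depths {suc j} {q} {F ▷ _} (stem c) = begin
    2 * (suc d + (depths F + 0) + q * q)   ≡⟨ lem d (depths F) q ⟩
    2 * suc d + 2 * (depths F + q * q)     ≡⟨ cong (2 * suc d +_) (caterpillar-depths c) ⟩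
    2 * suc d + d * suc d                  ≡⟨ lem′ d ⟩
    (suc d + 0) * suc (suc d + 0)          ∎
    where
    open ≡-Reasoning
    d = descendants F
    lem : ∀ d a q → 2 * (suc d + (a + 0) + q * q) ≡ 2 * suc d + 2 * (a + q * q)
    lem = solve-∀
    lem′ : ∀ d → 2 * suc d + d * suc d ≡ (suc d + 0) * suc (suc d + 0)
    lem′ = solve-∀

-- G is the union of X and Y, which share exactly their root.
record Split {n} (G : SimpleGraph n) (X Y : Tree (Fin n)) : Set where
  constructor mkSplit
  field
    roots≡    : root X ≡ root Y
    exhaust   : root X ∷ below X ++ below Y ↭ allFin n
    adj⇒arc   : ∀ {u v} → Adj G u v → (u , v) ∈ arcs X ++ arcs Y
    arc⇒adj   : ∀ {u v} → (u , v) ∈ arcs X ++ arcs Y → Adj G u v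

-- Moving branches and the root of a split

module _ {n} {G : SimpleGraph n} where

  resplit : ∀ {X Y X′ Y′} → root X′ ≡ root Y′ →
    root X ∷ below X ++ below Y ↭ root X′ ∷ below X′ ++ below Y′ →
    arcs X ++ arcs Y ↭ arcs X′ ++ arcs Y′ →
    Split G X Y → Split G X′ Y′
  resplit r b a (mkSplit _ e f g) = mkSplit r
    (↭-trans (↭-sym b) e)
    (λ uv → ∈-resp-↭ a (f uv))
    (λ uv → g (∈-resp-↭ (↭-sym a) uv))

  split-sym : ∀ {X Y} → Split G X Y → Split G Y X
  split-sym {X} {Y} s with r ← Split.roots≡ s =
    resplit (sym r)
      (subst (λ c → root X ∷ below X ++ below Y ↭ c ∷ below Y ++ below X) r
        (prep _ (++-comm (below X) (below Y))))
      (++-comm (arcs X) (arcs Y)) s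

  split-≈ : ∀ {X Y X′ Y′} → X ≈ X′ → Y ≈ Y′ → Split G X Y → Split G X′ Y′
  split-≈ {X} {Y} {X′} {Y′} (mk≈ p b a) (mk≈ p′ b′ a′) s =
    resplit (trans (sym p) (trans (Split.roots≡ s) p′))
      (subst (λ c → root X ∷ below X ++ below Y ↭ c ∷ below X′ ++ below Y′) p
        (prep _ (++⁺ b b′)))
      (++⁺ a a′) s

  private
    transfer : ∀ {A : Set} (xs ys : List A) {zs} → (xs ++ ys) ++ zs ↭ ys ++ (xs ++ zs)
    transfer xs ys {zs} = ↭-trans (↭-reflexive (++-assoc xs ys zs)) (shifts xs ys)

  move-branch : ∀ P {X Y} → Split G (P ▷ X) Y → Split G X (P ▷ Y)
  move-branch P {X} {Y} s with r ← Split.roots≡ s =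
    resplit r
      (prep _ (transfer (vertices P) (below X)))
      (subst (λ c → arcs (P ▷ X) ++ arcs Y ↭
                    arcs X ++ ((root P , c) ∷ (c , root P) ∷ arcs P) ++ arcs Y) r
        (transfer ((root P , root X) ∷ (root X , root P) ∷ arcs P) (arcs X))) s

  move-second-branch : ∀ P P′ {X Y} → Split G (P ▷ P′ ▷ X) Y → Split G (P ▷ X) (P′ ▷ Y)
  move-second-branch P P′ {X} s =
    move-branch P′ (split-≈ (▷-swap P P′ X) ≈-refl s)

  -- The edge between `c` and `root P` passes to the other side with child and parent exchanged. As
  -- `arcs` lists both directions, this is a mere reordering of the arcs.
  move-root : ∀ P {c Y} → Split G (P ▷ leaf c) Y → Split G P (Y ▷ leaf (root P))
  move-root P {c} {Y} s with refl ← Split.roots≡ s = resplit refl vs as s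
    where
    vs : c ∷ (vertices P ++ []) ++ below Y ↭ vertices P ++ (vertices Y ++ [])
    vs rewrite ++-identityʳ (below P) | ++-identityʳ (below Y) =
      ↭-sym (shift c (vertices P) (below Y))
    as : arcs (P ▷ leaf c) ++ arcs Y ↭ arcs P ++ arcs (Y ▷ leaf (root P))
    as rewrite ++-identityʳ (arcs P) | ++-identityʳ (arcs Y) =
      ↭-trans (↭-swap _ _ ↭-refl) (shifts ((c , root P) ∷ (root P , c) ∷ []) (arcs P))

  -- The two stems form one path through the root, and each `move-root` takes the root one step
  -- along it. Only the sum of the stem lengths belongs to the graph.
  slide : ∀ {i j a b X Y} l → Caterpillar i a X → Caterpillar (l + j) b Y → Split G X Y →
    ∃₂ λ X′ Y′ → Caterpillar (l + i) a X′ × Caterpillar j b Y′ × Split G X′ Y′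
  slide zero cX cY s = _ , _ , cX , cY , s
  slide {i} {j} {a} (suc l) cX (stem cY) s
    with X′ , Y′ , cX′ , cY′ , s′ ← slide l (stem cX) cY (split-sym (move-root _ (split-sym s)))
    = X′ , Y′ , subst (λ m → Caterpillar m a X′) lem cX′ , cY′ , s′
    where
    lem : l + suc i ≡ suc (l + i)
    lem = +-suc l i

-- Lists

module _ {A : Set} where

  unique-resp-↭ : {xs ys : List A} → xs ↭ ys → Unique xs → Unique ys
  unique-resp-↭ p = PermSetoid.Unique-resp-↭ (setoid A) (↭⇒↭ₛ p)

  unique∧set⇒↭ : {xs ys : List A} → Unique xs → Unique ys →
                 (∀ {x} → x ∈ xs ⇔ x ∈ ys) → xs ↭ ys
  unique∧set⇒↭ u v eq = ∼bag⇒↭ (unique∧set⇒bag u v eq)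

  unique-++⁻ : (xs : List A) {ys : List A} → Unique (xs ++ ys) →
               Unique xs × Unique ys × Disjoint xs ys
  unique-++⁻ [] u = [] , u , λ ()
  unique-++⁻ (x ∷ xs) (x∉ ∷ u) with ux , uy , d ← unique-++⁻ xs u =
    All.++⁻ˡ xs x∉ ∷ ux , uy ,
    λ { (here refl , v∈ys) → All.lookup (All.++⁻ʳ xs x∉) v∈ys refl
      ; (there v∈xs , v∈ys) → d (v∈xs , v∈ys) }

  filter-partition : {P Q : U.Pred A 0ℓ} (P? : U.Decidable P) (Q? : U.Decidable Q) →
    (∀ x → Q x ⇔ (¬ P x)) → (xs : List A) →
    length (filter P? xs) + length (filter Q? xs) ≡ length xs
  filter-partition P? Q? eq [] = refl
  filter-partition P? Q? eq (x ∷ xs) with P? x | Q? x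
  ... | yes p | yes q = contradiction p (Equivalence.to (eq x) q)
  ... | yes p | no  _ = cong suc (filter-partition P? Q? eq xs)
  ... | no ¬p | yes _ = trans (+-suc _ _) (cong suc (filter-partition P? Q? eq xs))
  ... | no ¬p | no ¬q = contradiction (Equivalence.from (eq x) ¬p) ¬q

count-members : ∀ {n} {P : U.Pred (Fin n) 0ℓ} (P? : U.Decidable P) {xs} → Unique xs →
                (∀ v → P v ⇔ v ∈ xs) → count P? ≡ length xs
count-members {n} P? u eq = ↭-length (unique∧set⇒↭ (Unique.filter⁺ P? (Unique.allFin⁺ n)) u
  (λ {v} → mk⇔ (λ v∈ → Equivalence.to (eq v) (proj₂ (∈-filter⁻ P? {xs = allFin n} v∈)))
               (λ v∈ → ∈-filter⁺ P? (∈-allFin v) (Equivalence.from (eq v) v∈))))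

-- Labelled trees inside a graph

module _ {V : Set} where

  vertices-▷ : (Y Z : Tree V) → vertices (Y ▷ Z) ↭ vertices Y ++ vertices Z
  vertices-▷ Y Z = ↭-sym (shift (root Z) (vertices Y) (below Z))

  length-below : (t : Tree V) → length (below t) ≡ descendants t
  length-below (leaf v) = refl
  length-below (Y ▷ Z) = cong suc
    (trans (length-++ (below Y)) (cong₂ _+_ (length-below Y) (length-below Z)))

  unique-▷ : (Y Z : Tree V) → Unique (vertices (Y ▷ Z)) →
    Unique (vertices Y) × Unique (vertices Z) × Disjoint (vertices Y) (vertices Z)
  unique-▷ Y Z u = unique-++⁻ (vertices Y) (unique-resp-↭ (vertices-▷ Y Z) u)

  root∈ : (t : Tree V) → root t ∈ vertices t
  root∈ t = here refl

  vertices-▷⁺ˡ : ∀ {Y Z : Tree V} {v} → v ∈ vertices Y → v ∈ vertices (Y ▷ Z)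
  vertices-▷⁺ˡ v∈ = there (∈-++⁺ˡ v∈)

  vertices-▷⁺ʳ : ∀ {Y Z : Tree V} {v} → v ∈ vertices Z → v ∈ vertices (Y ▷ Z)
  vertices-▷⁺ʳ (here eq) = here eq
  vertices-▷⁺ʳ {Y} (there v∈) = there (∈-++⁺ʳ (vertices Y) v∈)

  arc-▷⁻ : ∀ (Y Z : Tree V) {u v} → (u , v) ∈ arcs (Y ▷ Z) →
    (u ≡ root Y × v ≡ root Z) ⊎ (u ≡ root Z × v ≡ root Y) ⊎
    (u , v) ∈ arcs Y ⊎ (u , v) ∈ arcs Z
  arc-▷⁻ Y Z (here refl) = inj₁ (refl , refl)
  arc-▷⁻ Y Z (there (here refl)) = inj₂ (inj₁ (refl , refl))
  arc-▷⁻ Y Z (there (there a)) = inj₂ (inj₂ (∈-++⁻ (arcs Y) a))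

  arc-▷⁺ˡ : ∀ {Y Z : Tree V} {e} → e ∈ arcs Y → e ∈ arcs (Y ▷ Z)
  arc-▷⁺ˡ a = there (there (∈-++⁺ˡ a))

  arc-▷⁺ʳ : ∀ {Y Z : Tree V} {e} → e ∈ arcs Z → e ∈ arcs (Y ▷ Z)
  arc-▷⁺ʳ {Y} a = there (there (∈-++⁺ʳ (arcs Y) a))

  arc-ends : ∀ (t : Tree V) {u v} → (u , v) ∈ arcs t → u ∈ vertices t × v ∈ vertices t
  arc-ends (Y ▷ Z) a with arc-▷⁻ Y Z a
  ... | inj₁ (refl , refl) = vertices-▷⁺ˡ {Y} {Z} (root∈ Y) , here refl
  ... | inj₂ (inj₁ (refl , refl)) = here refl , vertices-▷⁺ˡ {Y} {Z} (root∈ Y)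
  ... | inj₂ (inj₂ (inj₁ b)) with u , v ← arc-ends Y b =
    vertices-▷⁺ˡ {Y} {Z} u , vertices-▷⁺ˡ {Y} {Z} v
  ... | inj₂ (inj₂ (inj₂ b)) with u , v ← arc-ends Z b =
    vertices-▷⁺ʳ {Y} {Z} u , vertices-▷⁺ʳ {Y} {Z} v

module _ {n} (G : SimpleGraph n) where

  -- t is joined to the rest of G through its root only.
  record Hangs (t : Tree (Fin n)) : Set where
    field
      unique  : Unique (vertices t)
      closed  : ∀ {u v} → u ∈ below t → Adj G u v → (u , v) ∈ arcs t
      arc⇒adj : ∀ {u v} → (u , v) ∈ arcs t → Adj G u v

  -- The edge from root Y to p is a bridge cutting off Y.
  record Branch (Y : Tree (Fin n)) (p : Fin n) : Set where
    field
      unique  : Unique (vertices Y)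
      parent  : Adj G (root Y) p
      outside : p ∉ vertices Y
      closed  : ∀ {u v} → u ∈ vertices Y → Adj G u v →
                (u , v) ∈ arcs Y ⊎ (u ≡ root Y × v ≡ p)
      arc⇒adj : ∀ {u v} → (u , v) ∈ arcs Y → Adj G u v

module _ {n} {G : SimpleGraph n} where

  branch⇒hangs : ∀ {Y p} → Branch G Y p → Hangs G Y
  branch⇒hangs {Y} b = record
    { unique  = Branch.unique b
    ; closed  = λ u∈ uv → [ (λ a → a) , (λ { (refl , _) →
                  contradiction u∈ (Unique.Unique[x∷xs]⇒x∉xs (Branch.unique b)) }) ]′
                  (Branch.closed b (there u∈) uv)
    ; arc⇒adj = Branch.arc⇒adj b
    }

  hangs-▷ : ∀ {Y Z} → Hangs G (Y ▷ Z) → Branch G Y (root Z) × Hangs G Z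
  hangs-▷ {Y} {Z} h with uY , uZ , Y#Z ← unique-▷ Y Z (Hangs.unique h) =
    record { unique = uY ; parent = Hangs.arc⇒adj h (here refl)
           ; outside = λ r∈ → Y#Z (r∈ , root∈ Z) ; closed = closedY
           ; arc⇒adj = λ a → Hangs.arc⇒adj h (arc-▷⁺ˡ {Y = Y} {Z} a) } ,
    record { unique = uZ ; closed = closedZ
           ; arc⇒adj = λ a → Hangs.arc⇒adj h (arc-▷⁺ʳ {Y = Y} {Z} a) }
    where
    closedY : ∀ {u v} → u ∈ vertices Y → Adj G u v →
              (u , v) ∈ arcs Y ⊎ (u ≡ root Y × v ≡ root Z)
    closedY u∈ uv with arc-▷⁻ Y Z (Hangs.closed h (∈-++⁺ˡ u∈) uv)
    ... | inj₁ e = inj₂ e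
    ... | inj₂ (inj₁ (refl , _)) = contradiction (u∈ , root∈ Z) Y#Z
    ... | inj₂ (inj₂ (inj₁ a)) = inj₁ a
    ... | inj₂ (inj₂ (inj₂ a)) = contradiction (u∈ , proj₁ (arc-ends Z a)) Y#Z
    closedZ : ∀ {u v} → u ∈ below Z → Adj G u v → (u , v) ∈ arcs Z
    closedZ u∈ uv with arc-▷⁻ Y Z (Hangs.closed h (∈-++⁺ʳ (vertices Y) u∈) uv)
    ... | inj₁ (refl , _) = contradiction (root∈ Y , there u∈) Y#Z
    ... | inj₂ (inj₁ (refl , _)) = contradiction u∈ (Unique.Unique[x∷xs]⇒x∉xs uZ)
    ... | inj₂ (inj₂ (inj₁ a)) = contradiction (proj₁ (arc-ends Y a) , there u∈) Y#Z
    ... | inj₂ (inj₂ (inj₂ a)) = a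

  split-unique : ∀ {X Y} → Split G X Y → Unique (root X ∷ below X ++ below Y)
  split-unique s = unique-resp-↭ (↭-sym (Split.exhaust s)) (Unique.allFin⁺ n)

  split-disjoint : ∀ {X Y} → Split G X Y → Disjoint (vertices X) (below Y)
  split-disjoint {X} s = proj₂ (proj₂ (unique-++⁻ (vertices X) (split-unique s)))

  split-hangsˡ : ∀ {X Y} → Split G X Y → Hangs G X
  split-hangsˡ {X} {Y} s = record
    { unique  = proj₁ (unique-++⁻ (vertices X) (split-unique s))
    ; closed  = closedX
    ; arc⇒adj = λ a → Split.arc⇒adj s (∈-++⁺ˡ a)
    }
    where
    closedX : ∀ {u v} → u ∈ below X → Adj G u v → (u , v) ∈ arcs X
    closedX u∈ uv with ∈-++⁻ (arcs X) (Split.adj⇒arc s uv)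
    ... | inj₁ a = a
    ... | inj₂ a with arc-ends Y a
    ...   | here refl , _ = contradiction u∈
              (subst (_∉ below X) (Split.roots≡ s)
                (Unique.Unique[x∷xs]⇒x∉xs (proj₁ (unique-++⁻ (vertices X) (split-unique s)))))
    ...   | there u∈Y , _ = contradiction (there u∈ , u∈Y) (split-disjoint s)

  split-hangsʳ : ∀ {X Y} → Split G X Y → Hangs G Y
  split-hangsʳ s = split-hangsˡ (split-sym s)

  split-order : ∀ {X Y} → Split G X Y → suc (descendants X + descendants Y) ≡ n
  split-order {X} {Y} s = begin
    suc (descendants X + descendants Y)
      ≡⟨ cong suc (cong₂ _+_ (length-below X) (length-below Y)) ⟨
    suc (length (below X) + length (below Y)) ≡⟨ cong suc (length-++ (below X)) ⟨
    suc (length (below X ++ below Y))         ≡⟨ ↭-length (Split.exhaust s) ⟩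
    length (allFin n)                         ≡⟨ length-tabulate (λ i → i) ⟩
    n                                         ∎
    where open ≡-Reasoning

-- Distances to the two ends of a bridge

module _ {n} {G : SimpleGraph n} (conn : Connected G) where

  dist-walk : ∀ u v → Walk G (dist G conn u v) u v
  dist-walk u v = let ℓ , w = conn u v in
    proj₁ (proj₂ (least (λ j → walk? G j u v) ℓ w))

  dist-≤ : ∀ {ℓ u v} → Walk G ℓ u v → dist G conn u v ≤ ℓ
  dist-≤ {ℓ} {u} {v} w = let ℓ₀ , w₀ = conn u v in
    proj₂ (proj₂ (least (λ j → walk? G j u v) ℓ₀ w₀)) ℓ w

module _ {n} {G : SimpleGraph n} {P : U.Pred (Fin n) 0ℓ} (P? : U.Decidable P) {u p : Fin n}
  (Pu : P u) (¬Pp : ¬ P p)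
  (crossing : ∀ {a b} → P a → ¬ P b → Adj G a b → a ≡ u × b ≡ p) where

  -- The walk has to leave `P`, and it can do so only along the edge from `u` to `p`. Cutting it
  -- before the first exit leaves a shorter walk that ends in `u`.
  cross-walk : ∀ ℓ {w} → P w → Walk G ℓ w p → ∃ λ ℓ′ → ℓ′ < ℓ × Walk G ℓ′ w u
  cross-walk zero Pw refl = contradiction Pw ¬Pp
  cross-walk (suc ℓ) Pw (x , wx , xp) with P? x
  ... | yes Px with ℓ′ , lt , xu ← cross-walk ℓ Px xp = suc ℓ′ , s≤s lt , x , wx , xu
  ... | no ¬Px with refl , _ ← crossing Pw ¬Px wx = 0 , z<s , refl

  cross-dist : (conn : Connected G) → ∀ {w} → P w → dist G conn w u < dist G conn w p
  cross-dist conn {w} Pw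
    with ℓ , lt , wu ← cross-walk _ Pw (dist-walk conn w p) =
    ≤-<-trans (dist-≤ conn wu) lt

module _ {n} {G : SimpleGraph n} (conn : Connected G) {P : U.Pred (Fin n) 0ℓ}
  (P? : U.Decidable P) {u p : Fin n} (Pu : P u) (¬Pp : ¬ P p)
  (crossing : ∀ {a b} → P a → ¬ P b → Adj G a b → a ≡ u × b ≡ p) where

  -- The assumptions are symmetric under exchanging `u` with `p` and `P` with its complement. So
  -- `cross-dist` applies on either side of the bridge, and no vertex is equally far from both ends.
  closer⇔ : ∀ w → dist G conn w u < dist G conn w p ⇔ P w
  closer⇔ w = mk⇔ to (cross-dist P? Pu ¬Pp crossing conn)
    where
    to : dist G conn w u < dist G conn w p → P w
    to lt with P? w
    ... | yes Pw = Pw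
    ... | no ¬Pw = contradiction lt (<-asym
      (cross-dist (¬? ∘ P?) ¬Pp (λ ¬Pu → ¬Pu Pu)
        (λ ¬Pa ¬¬Pb ab →
          let b≡u , a≡p = crossing (decidable-stable (P? _) ¬¬Pb) ¬Pa (adj-sym G ab)
          in a≡p , b≡u)
        conn ¬Pw))

module _ {n} {G : SimpleGraph n} (conn : Connected G) {Y : Tree (Fin n)} {p : Fin n}
  (b : Branch G Y p) where

  open DecMembership (Fin._≟_ {n}) using (_∈?_)

  branch-crossing : ∀ {u v} → u ∈ vertices Y → v ∉ vertices Y → Adj G u v →
                    u ≡ root Y × v ≡ p
  branch-crossing u∈ v∉ uv with Branch.closed b u∈ uv
  ... | inj₁ a = contradiction (proj₂ (arc-ends Y a)) v∉
  ... | inj₂ e = e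

  closer-branch : closer G conn (root Y) p ≡ suc (descendants Y)
  closer-branch = trans
    (count-members (λ w → dist G conn w (root Y) <? dist G conn w p) (Branch.unique b)
      (closer⇔ conn (_∈? vertices Y) (root∈ Y) (Branch.outside b) branch-crossing))
    (cong suc (length-below Y))

  closer-sum : closer G conn (root Y) p + closer G conn p (root Y) ≡ n
  closer-sum = trans
    (filter-partition (λ w → dist G conn w (root Y) <? dist G conn w p)
                      (λ w → dist G conn w p <? dist G conn w (root Y)) opposite (allFin n))
    (length-tabulate (λ i → i))
    where
    inside⇔ : ∀ w → dist G conn w (root Y) < dist G conn w p ⇔ w ∈ vertices Y
    inside⇔ = closer⇔ conn (_∈? vertices Y) (root∈ Y) (Branch.outside b) branch-crossing
    outside⇔ : ∀ w → dist G conn w p < dist G conn w (root Y) ⇔ w ∉ vertices Y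
    outside⇔ = closer⇔ conn (λ w → ¬? (w ∈? vertices Y)) (Branch.outside b) (λ r∉ → r∉ (root∈ Y))
      (λ a∉ ¬b∉ ab →
        let b≡ , a≡ = branch-crossing (decidable-stable (_ ∈? vertices Y) ¬b∉) a∉ (adj-sym G ab)
        in a≡ , b≡)
    opposite : ∀ w → dist G conn w p < dist G conn w (root Y) ⇔
                     (¬ dist G conn w (root Y) < dist G conn w p)
    opposite w = mk⇔ (λ lt → <-asym lt)
      (λ ≮ → Equivalence.from (outside⇔ w) (λ w∈ → ≮ (Equivalence.from (inside⇔ w) w∈)))

  imbalance-branch : ∣ closer G conn (root Y) p - closer G conn p (root Y) ∣ ≡
                     ∣ suc (descendants Y) - n ∸ suc (descendants Y) ∣
  imbalance-branch = cong₂ ∣_-_∣ closer-branch (begin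
    closer G conn p (root Y)                          ≡⟨ m+n∸m≡n (closer G conn (root Y) p) _ ⟨
    (closer G conn (root Y) p + closer G conn p (root Y)) ∸ closer G conn (root Y) p
      ≡⟨ cong₂ _∸_ closer-sum closer-branch ⟩
    n ∸ suc (descendants Y)                           ∎)
    where open ≡-Reasoning

-- Directed from child to parent.
links : ∀ {V} → Tree V → List (V × V)
links (leaf v) = []
links (Y ▷ Z)  = (root Y , root Z) ∷ links Y ++ links Z

imbalance : ∀ {V} → ℕ → Tree V → ℕ
imbalance n (leaf v) = 0
imbalance n (Y ▷ Z)  = ∣ suc (descendants Y) - n ∸ suc (descendants Y) ∣
                       + (imbalance n Y + imbalance n Z)

module _ {V : Set} where

  link⇒arc : ∀ (t : Tree V) {u v} → (u , v) ∈ links t → (u , v) ∈ arcs t × (v , u) ∈ arcs t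
  link⇒arc (Y ▷ Z) (here refl) = here refl , there (here refl)
  link⇒arc (Y ▷ Z) (there l) with ∈-++⁻ (links Y) l
  ... | inj₁ l′ with a , a′ ← link⇒arc Y l′ = arc-▷⁺ˡ {Y = Y} {Z} a , arc-▷⁺ˡ {Y = Y} {Z} a′
  ... | inj₂ l′ with a , a′ ← link⇒arc Z l′ = arc-▷⁺ʳ {Y = Y} {Z} a , arc-▷⁺ʳ {Y = Y} {Z} a′

  arc⇒link : ∀ (t : Tree V) {u v} → (u , v) ∈ arcs t → (u , v) ∈ links t ⊎ (v , u) ∈ links t
  arc⇒link (Y ▷ Z) a with arc-▷⁻ Y Z a
  ... | inj₁ (refl , refl) = inj₁ (here refl)
  ... | inj₂ (inj₁ (refl , refl)) = inj₂ (here refl)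
  ... | inj₂ (inj₂ (inj₁ b)) =
    [ (λ l → inj₁ (there (∈-++⁺ˡ l))) , (λ l → inj₂ (there (∈-++⁺ˡ l))) ]′ (arc⇒link Y b)
  ... | inj₂ (inj₂ (inj₂ b)) =
    [ (λ l → inj₁ (there (∈-++⁺ʳ (links Y) l))) , (λ l → inj₂ (there (∈-++⁺ʳ (links Y) l))) ]′
    (arc⇒link Z b)

  link-child : ∀ (t : Tree V) {u v} → (u , v) ∈ links t → u ∈ below t
  link-child (Y ▷ Z) (here refl) = here refl
  link-child (Y ▷ Z) (there l) with ∈-++⁻ (links Y) l
  ... | inj₁ l′ = ∈-++⁺ˡ {xs = vertices Y} (there (link-child Y l′))
  ... | inj₂ l′ = ∈-++⁺ʳ (vertices Y) (link-child Z l′)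

  link-ends : ∀ (t : Tree V) {u v} → (u , v) ∈ links t → u ∈ vertices t × v ∈ vertices t
  link-ends t l = arc-ends t (proj₁ (link⇒arc t l))

-- The Mostar index as a sum over the links of a split

module _ {n : ℕ} where

  -- `edges` lists each edge from its smaller end, `links` from child to parent. This map turns the
  -- second convention into the first.
  orient : Fin n × Fin n → Fin n × Fin n
  orient (u , v) with u Fin.<? v
  ... | yes _ = u , v
  ... | no  _ = v , u

  orient-< : ∀ {u v} → u Fin.< v → orient (u , v) ≡ (u , v)
  orient-< {u} {v} lt with u Fin.<? v
  ... | yes _ = refl
  ... | no ≮  = contradiction lt ≮

  orient-> : ∀ {u v} → v Fin.< u → orient (u , v) ≡ (v , u)
  orient-> {u} {v} lt with u Fin.<? v
  ... | yes lt′ = contradiction lt (<-asym lt′)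
  ... | no _  = refl

  orient-ends : ∀ {V : List (Fin n)} {u v} → u ∈ V → v ∈ V →
                proj₁ (orient (u , v)) ∈ V × proj₂ (orient (u , v)) ∈ V
  orient-ends {u = u} {v} u∈ v∈ with u Fin.<? v
  ... | yes _ = u∈ , v∈
  ... | no  _ = v∈ , u∈

  orient-ends⁻ : ∀ {V : List (Fin n)} {u v} →
                 proj₁ (orient (u , v)) ∈ V → proj₂ (orient (u , v)) ∈ V → u ∈ V × v ∈ V
  orient-ends⁻ {u = u} {v} u∈ v∈ with u Fin.<? v
  ... | yes _ = u∈ , v∈
  ... | no  _ = v∈ , u∈

  -- Having both ends in `V` does not depend on the orientation, and it separates the edges in `es`
  -- from those in `fs`.
  orient-disjoint : ∀ (V : List (Fin n)) (es fs : List (Fin n × Fin n)) →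
    (∀ {u v} → (u , v) ∈ es → u ∈ V × v ∈ V) →
    (∀ {u v} → (u , v) ∈ fs → u ∈ V → v ∉ V) →
    Disjoint (map orient es) (map orient fs)
  orient-disjoint V es fs inside apart (e∈ , f∈)
    with (u , v) , uv , refl ← ∈-map⁻ orient e∈
    with (u′ , v′) , uv′ , eq ← ∈-map⁻ orient f∈
    with u∈ , v∈ ← inside uv
    with o∈ , o∈′ ← orient-ends {V} u∈ v∈
    with u′∈ , v′∈ ← orient-ends⁻ {V} {u′} {v′}
           (subst (λ e → proj₁ e ∈ V) eq o∈) (subst (λ e → proj₂ e ∈ V) eq o∈′)
    = apart uv′ u′∈ v′∈

  orient-unique : ∀ (t : Tree (Fin n)) → Unique (vertices t) → Unique (map orient (links t))
  orient-unique (leaf v) _ = []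
  orient-unique (Y ▷ Z) u with uY , uZ , Y#Z ← unique-▷ Y Z u =
    subst (λ es → Unique (orient (root Y , root Z) ∷ es)) (sym (map-++ orient (links Y) (links Z)))
      (Unique.++⁺ {xs = map orient ((root Y , root Z) ∷ [])} ([] ∷ [])
        (Unique.++⁺ (orient-unique Y uY) (orient-unique Z uZ)
          (orient-disjoint (vertices Y) (links Y) (links Z) (link-ends Y)
            (λ l u∈ _ → Y#Z (u∈ , there (link-child Z l)))))
        λ { (o∈ , l) → [ (λ lY → orient-disjoint (vertices Y) (links Y) ((root Y , root Z) ∷ [])
                             (link-ends Y) (λ { (here refl) _ r∈ → Y#Z (r∈ , root∈ Z) })
                             (lY , o∈))
                       , (λ lZ → orient-disjoint (vertices Z) (links Z) ((root Y , root Z) ∷ [])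
                             (link-ends Z) (λ { (here refl) r∈ _ → Y#Z (root∈ Y , r∈) })
                             (lZ , o∈)) ]′
                       (∈-++⁻ (map orient (links Y)) l) })

module _ {n} {G : SimpleGraph n} where

  edges↭links : ∀ {X Y} → Split G X Y → edges G ↭ map orient (links X ++ links Y)
  edges↭links {X} {Y} s = unique∧set⇒↭
    (Unique.filter⁺ (edge? G) (Unique.cartesianProduct⁺ (Unique.allFin⁺ n) (Unique.allFin⁺ n)))
    (subst Unique (sym (map-++ orient (links X) (links Y)))
      (Unique.++⁺ (orient-unique X (Hangs.unique (split-hangsˡ s)))
                  (orient-unique Y (Hangs.unique (split-hangsʳ s)))
        (orient-disjoint (vertices X) (links X) (links Y) (link-ends X)
          (λ l u∈ _ → split-disjoint s (u∈ , link-child Y l)))))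
    (mk⇔ to from)
    where
    to : ∀ {e} → e ∈ edges G → e ∈ map orient (links X ++ links Y)
    to {u , v} e∈ 
      with _ , u<v , uv ← ∈-filter⁻ (edge? G) {xs = cartesianProduct (allFin n) (allFin n)} e∈
      with ∈-++⁻ (arcs X) (Split.adj⇒arc s uv)
    ... | inj₁ a = [ (λ l → subst (_∈ _) (orient-< u<v) (∈-map⁺ orient (∈-++⁺ˡ l)))
                   , (λ l → subst (_∈ _) (orient-> u<v) (∈-map⁺ orient (∈-++⁺ˡ l))) ]′ (arc⇒link X a)
    ... | inj₂ a = [ (λ l → subst (_∈ _) (orient-< u<v) (∈-map⁺ orient (∈-++⁺ʳ (links X) l)))
                   , (λ l → subst (_∈ _) (orient-> u<v) (∈-map⁺ orient (∈-++⁺ʳ (links X) l))) ]′ (arc⇒link Y a)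
    link-adj : ∀ {u v} → (u , v) ∈ links X ++ links Y → Adj G u v
    link-adj l with ∈-++⁻ (links X) l
    ... | inj₁ l′ = Split.arc⇒adj s (∈-++⁺ˡ (proj₁ (link⇒arc X l′)))
    ... | inj₂ l′ = Split.arc⇒adj s (∈-++⁺ʳ (arcs X) (proj₁ (link⇒arc Y l′)))
    is-edge : ∀ {u v} → u Fin.< v → Adj G u v → (u , v) ∈ edges G
    is-edge u<v uv = ∈-filter⁺ (edge? G) (∈-cartesianProduct⁺ (∈-allFin _) (∈-allFin _)) (u<v , uv)
    from : ∀ {e} → e ∈ map orient (links X ++ links Y) → e ∈ edges G
    from e∈ with (u , v) , l , refl ← ∈-map⁻ orient e∈ with Fin.<-cmp u v
    ... | tri< u<v _ _ = subst (_∈ edges G) (sym (orient-< u<v)) (is-edge u<v (link-adj l))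
    ... | tri≈ _ u≡v _ = contradiction (link-adj l) (adj-irrefl G u≡v)
    ... | tri> _ _ v<u = subst (_∈ edges G) (sym (orient-> v<u)) (is-edge v<u (adj-sym G (link-adj l)))

  module _ (conn : Connected G) where

    weight : Fin n × Fin n → ℕ
    weight (u , v) = ∣ closer G conn u v - closer G conn v u ∣

    weight-orient : ∀ e → weight (orient e) ≡ weight e
    weight-orient (u , v) with u Fin.<? v
    ... | yes _ = refl
    ... | no  _ = ∣-∣-comm (closer G conn v u) (closer G conn u v)

    weight-links : ∀ t → Hangs G t → sum (map weight (links t)) ≡ imbalance n t
    weight-links (leaf v) _ = refl
    weight-links (Y ▷ Z) h with b , hZ ← hangs-▷ h = cong₂ _+_ (imbalance-branch conn b) (begin
      sum (map weight (links Y ++ links Z))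
        ≡⟨ cong sum (map-++ weight (links Y) (links Z)) ⟩
      sum (map weight (links Y) ++ map weight (links Z))
        ≡⟨ sum-++ (map weight (links Y)) _ ⟩
      sum (map weight (links Y)) + sum (map weight (links Z))
        ≡⟨ cong₂ _+_ (weight-links Y (branch⇒hangs b)) (weight-links Z hZ) ⟩
      imbalance n Y + imbalance n Z ∎)
      where open ≡-Reasoning

    Mo-split : ∀ {X Y} → Split G X Y → Mo G conn ≡ imbalance n X + imbalance n Y
    Mo-split {X} {Y} s = begin
      sum (map weight (edges G))
        ≡⟨ sum-↭ (↭-map⁺ weight (edges↭links s)) ⟩
      sum (map weight (map orient (links X ++ links Y)))
        ≡⟨ cong sum (trans (sym (map-∘ (links X ++ links Y)))
                           (map-cong weight-orient (links X ++ links Y))) ⟩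
      sum (map weight (links X ++ links Y))
        ≡⟨ cong sum (map-++ weight (links X) (links Y)) ⟩
      sum (map weight (links X) ++ map weight (links Y))
        ≡⟨ sum-++ (map weight (links X)) _ ⟩
      sum (map weight (links X)) + sum (map weight (links Y))
        ≡⟨ cong₂ _+_ (weight-links X (split-hangsˡ s)) (weight-links Y (split-hangsʳ s)) ⟩
      imbalance n X + imbalance n Y ∎
      where open ≡-Reasoning

-- Estimating the Mostar index by depths

module _ {V : Set} (n : ℕ) where

  private
    regroup : ∀ w i j s a b → (w + 2 * s) + ((i + 2 * a) + (j + 2 * b)) ≡
                              w + (i + j) + 2 * (s + (a + b))
    regroup = solve-∀

  -- A vertex at distance d from the root lies below exactly d links, so the sizes s below the links
  -- add up to `depths t`. The estimate is stated additively because n - 2s may be negative.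
  imbalance-≥ : (t : Tree V) → n * descendants t ≤ imbalance n t + 2 * depths t
  imbalance-≥ (leaf v) = ≤-reflexive (*-zeroʳ n)
  imbalance-≥ (Y ▷ Z) = begin
    n * (suc (descendants Y) + descendants Z)
      ≡⟨ lem n (descendants Y) (descendants Z) ⟩
    n + (n * descendants Y + n * descendants Z)
      ≤⟨ +-mono-≤ (gap n (suc (descendants Y))) (+-mono-≤ (imbalance-≥ Y) (imbalance-≥ Z)) ⟩
    (∣ s - n ∸ s ∣ + 2 * s) + ((imbalance n Y + 2 * depths Y) + (imbalance n Z + 2 * depths Z))
      ≡⟨ regroup ∣ s - n ∸ s ∣ (imbalance n Y) (imbalance n Z) s (depths Y) (depths Z) ⟩
    imbalance n (Y ▷ Z) + 2 * depths (Y ▷ Z) ∎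
    where
    open ≤-Reasoning
    s = suc (descendants Y)
    lem : ∀ n y z → n * (suc y + z) ≡ n + (n * y + n * z)
    lem = solve-∀
    gap : ∀ n s → n ≤ ∣ s - n ∸ s ∣ + 2 * s
    gap n s = begin
      n                              ≤⟨ m≤n+m∸n n s ⟩
      s + (n ∸ s)                    ≤⟨ +-monoʳ-≤ s (m≤n+∣n-m∣ (n ∸ s) s) ⟩
      s + (s + ∣ s - n ∸ s ∣)        ≡⟨ lem′ s ∣ s - n ∸ s ∣ ⟩
      ∣ s - n ∸ s ∣ + 2 * s          ∎
      where
      lem′ : ∀ s w → s + (s + w) ≡ w + 2 * s
      lem′ = solve-∀

  imbalance-≡ : (t : Tree V) → 2 * descendants t ≤ n →
                imbalance n t + 2 * depths t ≡ n * descendants t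
  imbalance-≡ (leaf v) _ = sym (*-zeroʳ n)
  imbalance-≡ (Y ▷ Z) 2t≤n = begin
    imbalance n (Y ▷ Z) + 2 * depths (Y ▷ Z)
      ≡⟨ regroup ∣ s - n ∸ s ∣ (imbalance n Y) (imbalance n Z) s (depths Y) (depths Z) ⟨
    (∣ s - n ∸ s ∣ + 2 * s) + ((imbalance n Y + 2 * depths Y) + (imbalance n Z + 2 * depths Z))
      ≡⟨ cong₂ _+_ gap (cong₂ _+_ (imbalance-≡ Y 2Y≤n) (imbalance-≡ Z 2Z≤n)) ⟩
    n + (n * descendants Y + n * descendants Z)
      ≡⟨ lem n (descendants Y) (descendants Z) ⟨
    n * (suc (descendants Y) + descendants Z) ∎
    where
    open ≡-Reasoning
    s = suc (descendants Y)
    2s≤n : 2 * s ≤ n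
    2s≤n = ≤-trans (*-monoʳ-≤ 2 (m≤m+n s (descendants Z))) 2t≤n
    2Y≤n : 2 * descendants Y ≤ n
    2Y≤n = ≤-trans (*-monoʳ-≤ 2 (n≤1+n (descendants Y))) 2s≤n
    2Z≤n : 2 * descendants Z ≤ n
    2Z≤n = ≤-trans (*-monoʳ-≤ 2 (m≤n+m (descendants Z) s)) 2t≤n
    s+s≤n : s + s ≤ n
    s+s≤n = subst (λ m → s + m ≤ n) (+-identityʳ s) 2s≤n
    lem : ∀ n y z → n * (suc y + z) ≡ n + (n * y + n * z)
    lem = solve-∀
    gap : ∣ s - n ∸ s ∣ + 2 * s ≡ n
    gap = begin
      ∣ s - n ∸ s ∣ + 2 * s    ≡⟨ cong₂ _+_ (m≤n⇒∣m-n∣≡n∸m (m+n≤o⇒m≤o∸n s s+s≤n))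
                                          (cong (s +_) (+-identityʳ s)) ⟩
      (n ∸ s ∸ s) + (s + s)    ≡⟨ cong (_+ (s + s)) (∸-+-assoc n s s) ⟩
      (n ∸ (s + s)) + (s + s)  ≡⟨ m∸n+n≡m s+s≤n ⟩
      n                        ∎

module _ {n} {G : SimpleGraph n} (conn : Connected G) {X Y} (s : Split G X Y) where

  private
    total : n * (descendants X + descendants Y) ≡ n * descendants X + n * descendants Y
    total = *-distribˡ-+ n (descendants X) (descendants Y)

    regroup : ∀ i j a b → (i + 2 * a) + (j + 2 * b) ≡ i + j + 2 * (a + b)
    regroup = solve-∀

  -- There is no condition on the sizes: a link with more than half of the vertices below it only
  -- makes the inequality strict. So one graph yields an inequality for each of its splits.
  Mo-≥ : n * (descendants X + descendants Y) ≤ Mo G conn + 2 * (depths X + depths Y)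
  Mo-≥ = begin
    n * (descendants X + descendants Y)       ≡⟨ total ⟩
    n * descendants X + n * descendants Y     ≤⟨ +-mono-≤ (imbalance-≥ n X) (imbalance-≥ n Y) ⟩
    (imbalance n X + 2 * depths X) + (imbalance n Y + 2 * depths Y)
      ≡⟨ regroup (imbalance n X) (imbalance n Y) (depths X) (depths Y) ⟩
    imbalance n X + imbalance n Y + 2 * (depths X + depths Y)
      ≡⟨ cong (_+ _) (Mo-split conn s) ⟨
    Mo G conn + 2 * (depths X + depths Y) ∎
    where open ≤-Reasoning

  Mo-≡ : 2 * descendants X ≤ n → 2 * descendants Y ≤ n →
         Mo G conn + 2 * (depths X + depths Y) ≡ n * (descendants X + descendants Y)
  Mo-≡ 2X≤n 2Y≤n = begin
    Mo G conn + 2 * (depths X + depths Y) ≡⟨ cong (_+ _) (Mo-split conn s) ⟩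
    imbalance n X + imbalance n Y + 2 * (depths X + depths Y)
      ≡⟨ regroup (imbalance n X) (imbalance n Y) (depths X) (depths Y) ⟨
    (imbalance n X + 2 * depths X) + (imbalance n Y + 2 * depths Y)
      ≡⟨ cong₂ _+_ (imbalance-≡ n X 2X≤n) (imbalance-≡ n Y 2Y≤n) ⟩
    n * descendants X + n * descendants Y ≡⟨ total ⟨
    n * (descendants X + descendants Y)   ∎
    where open ≡-Reasoning

-- Counting odd vertices

children : ∀ {V} → Tree V → List V
children (leaf v) = []
children (Y ▷ Z)  = root Y ∷ children Z

isOdd : ℕ → Bool
isOdd zero    = false
isOdd (suc m) = not (isOdd m)

isOdd-% : ∀ m → m % 2 ≡ ⟦ isOdd m ⟧
isOdd-% zero = refl
isOdd-% (suc zero) = refl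
isOdd-% (suc (suc m)) with isOdd m | isOdd-% m
... | false | eq = eq
... | true  | eq = eq

isOdd-+ : ∀ l m → isOdd (l + m) ≡ isOdd l xor isOdd m
isOdd-+ zero m = refl
isOdd-+ (suc l) m = trans (cong not (isOdd-+ l m)) (not-distribˡ-xor (isOdd l) (isOdd m))

module _ {V : Set} where

  isOdd-children : (t : Tree V) → isOdd (length (children t)) ≡ odd t
  isOdd-children (leaf v) = refl
  isOdd-children (Y ▷ Z)  = cong not (isOdd-children Z)

  children⊆below : ∀ (t : Tree V) {v} → v ∈ children t → v ∈ below t
  children⊆below (Y ▷ Z) (here refl) = here refl
  children⊆below (Y ▷ Z) (there v∈) = ∈-++⁺ʳ (vertices Y) (children⊆below Z v∈)

  children-unique : (t : Tree V) → Unique (vertices t) → Unique (children t)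
  children-unique (leaf v) _ = []
  children-unique (Y ▷ Z) u with uY , uZ , Y#Z ← unique-▷ Y Z u =
    All.¬Any⇒All¬ (children Z) (λ r∈ → Y#Z (root∈ Y , there (children⊆below Z r∈))) ∷ children-unique Z uZ

  child⇒arc : ∀ (t : Tree V) {v} → v ∈ children t → (root t , v) ∈ arcs t
  child⇒arc (Y ▷ Z) (here refl) = there (here refl)
  child⇒arc (Y ▷ Z) (there v∈) = arc-▷⁺ʳ {Y = Y} {Z} (child⇒arc Z v∈)

  arc⇒child : ∀ (t : Tree V) → Unique (vertices t) → ∀ {v} → (root t , v) ∈ arcs t → v ∈ children t
  arc⇒child (Y ▷ Z) u a with uY , uZ , Y#Z ← unique-▷ Y Z u with arc-▷⁻ Y Z a
  ... | inj₁ (eq , _) = contradiction (root∈ Y , here (sym eq)) Y#Z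
  ... | inj₂ (inj₁ (_ , refl)) = here refl
  ... | inj₂ (inj₂ (inj₁ b)) = contradiction (proj₁ (arc-ends Y b) , root∈ Z) Y#Z
  ... | inj₂ (inj₂ (inj₂ b)) = there (arc⇒child Z uZ b)

module _ {n} {G : SimpleGraph n} where

  oddCount : List (Fin n) → ℕ
  oddCount vs = length (filter (oddVertex? G) vs)

  oddCount-∷ : ∀ v vs {b} → isOdd (degree G v) ≡ b → oddCount (v ∷ vs) ≡ ⟦ b ⟧ + oddCount vs
  oddCount-∷ v vs {true} p = cong length (filter-accept (oddVertex? G) {v} {vs}
    (trans (isOdd-% (degree G v)) (cong ⟦_⟧ p)))
  oddCount-∷ v vs {false} p = cong length (filter-reject (oddVertex? G) {v} {vs}
    (λ o → contradiction (trans (sym (trans (isOdd-% (degree G v)) (cong ⟦_⟧ p))) o) λ ()))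

  oddCount-++ : ∀ us vs → oddCount (us ++ vs) ≡ oddCount us + oddCount vs
  oddCount-++ us vs = trans (cong length (filter-++ (oddVertex? G) us vs))
    (length-++ (filter (oddVertex? G) us))

  degree-branch : ∀ {Y p} → Branch G Y p → degree G (root Y) ≡ suc (length (children Y))
  degree-branch {Y} {p} b = count-members (adj? G (root Y))
    (All.¬Any⇒All¬ (children Y) (λ p∈ → Branch.outside b (there (children⊆below Y p∈)))
      ∷ children-unique Y (Branch.unique b))
    λ v → mk⇔ to from
    where
    to : ∀ {v} → Adj G (root Y) v → v ∈ p ∷ children Y
    to a with Branch.closed b (root∈ Y) a
    ... | inj₁ c = there (arc⇒child Y (Branch.unique b) c)
    ... | inj₂ (_ , refl) = here refl
    from : ∀ {v} → v ∈ p ∷ children Y → Adj G (root Y) v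
    from (here refl) = Branch.parent b
    from (there c) = Branch.arc⇒adj b (child⇒arc Y c)

  -- The degree of the root depends on what else is attached there. It is replaced by `not (odd t)`,
  -- its parity with one further neighbour, which is the true parity once `t` is a branch.
  oddCount-below : ∀ t → Hangs G t → oddCount (below t) + ⟦ not (odd t) ⟧ ≡ suc (2 * twigs t)
  oddCount-below (leaf v) _ = refl
  oddCount-below (Y ▷ Z) h with b , hZ ← hangs-▷ h = begin
    oddCount (root Y ∷ below Y ++ below Z) + ⟦ not (not (odd Z)) ⟧
      ≡⟨ cong (_+ _) (trans (oddCount-∷ (root Y) (below Y ++ below Z) root-parity)
                            (cong (⟦ not (odd Y) ⟧ +_) (oddCount-++ (below Y) (below Z)))) ⟩
    ⟦ not (odd Y) ⟧ + (oddCount (below Y) + oddCount (below Z)) + ⟦ not (not (odd Z)) ⟧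
      ≡⟨ lem ⟦ not (odd Y) ⟧ (oddCount (below Y)) (oddCount (below Z)) ⟦ not (not (odd Z)) ⟧ ⟩
    (oddCount (below Y) + ⟦ not (odd Y) ⟧) + (oddCount (below Z) + ⟦ not (not (odd Z)) ⟧)
      ≡⟨ cong (_+ (oddCount (below Z) + ⟦ not (not (odd Z)) ⟧)) (oddCount-below Y (branch⇒hangs b)) ⟩
    suc (2 * twigs Y) + (oddCount (below Z) + ⟦ not (not (odd Z)) ⟧)
      ≡⟨ finish (odd Z) (oddCount (below Z)) (twigs Y) (twigs Z) (oddCount-below Z hZ) ⟩
    suc (2 * twigs (Y ▷ Z)) ∎
    where
    open ≡-Reasoning
    root-parity : isOdd (degree G (root Y)) ≡ not (odd Y)
    root-parity = trans (cong isOdd (degree-branch b)) (cong not (isOdd-children Y))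
    lem : ∀ a b c d → a + (b + c) + d ≡ (b + a) + (c + d)
    lem = solve-∀
    finish : ∀ o m i j → m + ⟦ not o ⟧ ≡ suc (2 * j) →
             suc (2 * i) + (m + ⟦ not (not o) ⟧) ≡ suc (2 * (i + j + ⟦ o ⟧))
    finish false m i j eq = trans (cong (suc (2 * i) +_) (trans (+-identityʳ m)
      (suc-injective (trans (+-comm 1 m) eq)))) (lem′ i j)
      where
      lem′ : ∀ i j → suc (2 * i) + 2 * j ≡ suc (2 * (i + j + 0))
      lem′ = solve-∀
    finish true m i j eq = trans (cong (λ l → suc (2 * i) + (l + 1))
      (trans (sym (+-identityʳ m)) eq)) (lem′ i j)
      where
      lem′ : ∀ i j → suc (2 * i) + (suc (2 * j) + 1) ≡ suc (2 * (i + j + 1))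
      lem′ = solve-∀

  degree-split : ∀ {X Y} → Split G X Y →
    degree G (root X) ≡ length (children X ++ children Y)
  degree-split {X} {Y} s = count-members (adj? G (root X))
    (Unique.++⁺ (children-unique X (Hangs.unique hX)) (children-unique Y (Hangs.unique hY))
      λ (x∈ , y∈) → split-disjoint s (there (children⊆below X x∈) , children⊆below Y y∈))
    λ v → mk⇔ to from
    where
    hX = split-hangsˡ s
    hY = split-hangsʳ s
    to : ∀ {v} → Adj G (root X) v → v ∈ children X ++ children Y
    to {v} a with ∈-++⁻ (arcs X) (Split.adj⇒arc s a)
    ... | inj₁ c = ∈-++⁺ˡ (arc⇒child X (Hangs.unique hX) c)
    ... | inj₂ c = ∈-++⁺ʳ (children X) (arc⇒child Y (Hangs.unique hY)
                     (subst (λ r → (r , v) ∈ arcs Y) (Split.roots≡ s) c))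
    from : ∀ {v} → v ∈ children X ++ children Y → Adj G (root X) v
    from {v} v∈ with ∈-++⁻ (children X) v∈
    ... | inj₁ c = Split.arc⇒adj s (∈-++⁺ˡ (child⇒arc X c))
    ... | inj₂ c = Split.arc⇒adj s (∈-++⁺ʳ (arcs X)
                     (subst (λ r → (r , v) ∈ arcs Y) (sym (Split.roots≡ s)) (child⇒arc Y c)))

  -- Besides the root there are `2 * twigs X + ⟦ odd X ⟧` odd vertices in `X`, and likewise in `Y`.
  -- For truth values p and q as numbers, p + q + (p xor q) = 2 (p ∨ q).
  count-odd : ∀ {X Y} → Split G X Y →
    count (oddVertex? G) ≡ 2 * (twigs X + twigs Y + ⟦ odd X ∨ odd Y ⟧)
  count-odd {X} {Y} s = begin
    count (oddVertex? G)
      ≡⟨ ↭-length (filter-↭ (oddVertex? G) (Split.exhaust s)) ⟨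
    oddCount (root X ∷ below X ++ below Y)
      ≡⟨ oddCount-∷ (root X) (below X ++ below Y) root-parity ⟩
    ⟦ odd X xor odd Y ⟧ + oddCount (below X ++ below Y)
      ≡⟨ cong (_ +_) (oddCount-++ (below X) (below Y)) ⟩
    ⟦ odd X xor odd Y ⟧ + (oddCount (below X) + oddCount (below Y))
      ≡⟨ finish (odd X) (odd Y) _ _ (twigs X) (twigs Y) (oddCount-below X (split-hangsˡ s))
                                        (oddCount-below Y (split-hangsʳ s)) ⟩
    2 * (twigs X + twigs Y + ⟦ odd X ∨ odd Y ⟧) ∎
    where
    open ≡-Reasoning
    root-parity : isOdd (degree G (root X)) ≡ odd X xor odd Y
    root-parity = trans (cong isOdd (trans (degree-split s) (length-++ (children X))))
      (trans (isOdd-+ (length (children X)) (length (children Y)))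
             (cong₂ _xor_ (isOdd-children X) (isOdd-children Y)))
    even : ∀ {m i} → m + 1 ≡ suc (2 * i) → m ≡ 2 * i
    even {m} eq = suc-injective (trans (+-comm 1 m) eq)
    odd′ : ∀ {m i} → m + 0 ≡ suc (2 * i) → m ≡ suc (2 * i)
    odd′ {m} eq = trans (sym (+-identityʳ m)) eq
    finish : ∀ a b l m i j → l + ⟦ not a ⟧ ≡ suc (2 * i) → m + ⟦ not b ⟧ ≡ suc (2 * j) →
             ⟦ a xor b ⟧ + (l + m) ≡ 2 * (i + j + ⟦ a ∨ b ⟧)
    finish false false l m i j eq eq′ rewrite even {l} {i} eq | even {m} {j} eq′ = lem i j
      where
      lem : ∀ i j → 2 * i + 2 * j ≡ 2 * (i + j + 0)
      lem = solve-∀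
    finish false true l m i j eq eq′ rewrite even {l} {i} eq | odd′ {m} {j} eq′ = lem i j
      where
      lem : ∀ i j → 1 + (2 * i + suc (2 * j)) ≡ 2 * (i + j + 1)
      lem = solve-∀
    finish true false l m i j eq eq′ rewrite odd′ {l} {i} eq | even {m} {j} eq′ = lem i j
      where
      lem : ∀ i j → 1 + (suc (2 * i) + 2 * j) ≡ 2 * (i + j + 1)
      lem = solve-∀
    finish true true l m i j eq eq′ rewrite odd′ {l} {i} eq | odd′ {m} {j} eq′ = lem i j
      where
      lem : ∀ i j → suc (2 * i) + suc (2 * j) ≡ 2 * (i + j + 1)
      lem = solve-∀

-- Lower bounds for the slack

slack-mono : ∀ {i i′ e e′ j j′ f f′} → i ≤ i′ → e ≤ e′ → j ≤ j′ → f ≤ f′ →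
             slack true i e j f ≤ slack true i′ e′ j′ f′
slack-mono i e j f =
  +-mono-≤ (+-mono-≤ (+-mono-≤ (*-monoʳ-≤ 2 (*-mono-≤ i j))
                               (*-mono-≤ (+-monoˡ-≤ 1 (*-monoʳ-≤ 2 i)) f))
                     (*-mono-≤ e (+-monoˡ-≤ 1 (*-monoʳ-≤ 2 j))))
           (*-mono-≤ e f)

-- With the p and z of `slack`, the left side is 2(p + 1)z, which exceeds g² as soon as p and z are
-- at least g > 0.
slack-false-≥ : ∀ i e j f → 2 * (suc (2 * i + 1 + e) * (2 * j + 0 + f)) ≤ 4 * slack false i e j f
slack-false-≥ i e j f = m+n≤o⇒m≤o _ (≤-reflexive (lem i e j f))
  where
  lem : ∀ i e j f →
    2 * (suc (2 * i + 1 + e) * (2 * j + 0 + f)) + (4 * (i * f) + 4 * (e * j) + 2 * (e * f)) ≡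
    4 * (2 * (i * j) + 2 * (i * f) + 2 * j + f + 2 * (e * j) + e * f)
  lem = solve-∀

-- With the p and z of `slack`, the left side is 2(p - 1)(z - 1). Since 2(g - 1)² exceeds g² only
-- from g = 4 on, the gaps 2 and 3 are left to `slack-≥2` and `slack-≥3`.
slack-true-≥ : ∀ i e j f → 2 * ((2 * i + e) * (2 * j + f)) ≤ 4 * slack true i e j f
slack-true-≥ i e j f = m+n≤o⇒m≤o _ (≤-reflexive (lem i e j f))
  where
  lem : ∀ i e j f →
    2 * ((2 * i + e) * (2 * j + f)) + (4 * (i * f) + 4 * f + 4 * (e * j) + 4 * e + 2 * (e * f)) ≡
    4 * (2 * (i * j) + (2 * i + 1) * f + e * (2 * j + 1) + e * f)
  lem = solve-∀

≤-slack : ∀ i e j f i₀ e₀ j₀ f₀ → i₀ ≤ i → e₀ ≤ e → j₀ ≤ j → f₀ ≤ f →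
          ∀ {m} → m ≤ slack true i₀ e₀ j₀ f₀ → m ≤ slack true i e j f
≤-slack i e j f i₀ e₀ j₀ f₀ i≥ e≥ j≥ f≥ m≤ =
  ≤-trans m≤ (slack-mono {i₀} {i} {e₀} {e} {j₀} {j} {f₀} {f} i≥ e≥ j≥ f≥)

slack-≥2 : ∀ i e j f → 1 ≤ 2 * i + e → 1 ≤ 2 * j + f → 2 ≤ slack true i e j f
slack-≥2 (suc i) e (suc j) f _ _ =
  ≤-slack (suc i) e (suc j) f 1 0 1 0 (s≤s z≤n) z≤n (s≤s z≤n) z≤n ≤-refl
slack-≥2 (suc i) e zero (suc f) _ _ =
  ≤-slack (suc i) e zero (suc f) 1 0 0 1 (s≤s z≤n) z≤n z≤n (s≤s z≤n) (m≤m+n 2 1)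
slack-≥2 zero (suc e) (suc j) f _ _ =
  ≤-slack zero (suc e) (suc j) f 0 1 1 0 z≤n (s≤s z≤n) (s≤s z≤n) z≤n (m≤m+n 2 1)
slack-≥2 zero (suc e) zero (suc f) _ _ =
  ≤-slack zero (suc e) zero (suc f) 0 1 0 1 z≤n (s≤s z≤n) z≤n (s≤s z≤n) (m≤m+n 2 1)

slack-≥3 : ∀ i e j f → 2 ≤ 2 * i + e → 2 ≤ 2 * j + f →
           3 ≤ slack true i e j f ⊎ (i ≡ 1 × e ≡ 0 × j ≡ 1 × f ≡ 0)
slack-≥3 1 0 1 0 _ _ = inj₂ (refl , refl , refl , refl)
slack-≥3 (suc (suc i)) e (suc j) f _ _ =
  inj₁ (≤-slack (suc (suc i)) e (suc j) f 2 0 1 0 (s≤s (s≤s z≤n)) z≤n (s≤s z≤n) z≤n (m≤m+n 3 1))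
slack-≥3 1 (suc e) (suc j) f _ _ =
  inj₁ (≤-slack 1 (suc e) (suc j) f 1 1 1 0 (s≤s z≤n) (s≤s z≤n) (s≤s z≤n) z≤n (m≤m+n 3 2))
slack-≥3 1 0 (suc (suc j)) f _ _ =
  inj₁ (≤-slack 1 0 (suc (suc j)) f 1 0 2 0 (s≤s z≤n) z≤n (s≤s (s≤s z≤n)) z≤n (m≤m+n 3 1))
slack-≥3 1 0 1 (suc f) _ _ =
  inj₁ (≤-slack 1 0 1 (suc f) 1 0 1 1 (s≤s z≤n) z≤n (s≤s z≤n) (s≤s z≤n) (m≤m+n 3 2))
slack-≥3 (suc i) e zero f _ 2≤f =
  inj₁ (≤-slack (suc i) e zero f 1 0 0 2 (s≤s z≤n) z≤n z≤n 2≤f (m≤m+n 3 3))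
slack-≥3 zero e (suc j) f 2≤e _ =
  inj₁ (≤-slack zero e (suc j) f 0 2 1 0 z≤n 2≤e (s≤s z≤n) z≤n (m≤m+n 3 3))
slack-≥3 zero e zero f 2≤e 2≤f =
  inj₁ (≤-slack zero e zero f 0 2 0 2 z≤n 2≤e z≤n 2≤f (m≤m+n 3 5))

-- The exception comes from three copies of the tree on three vertices, hung by
-- their middle vertices from a common root.
slack-> : ∀ g b i e j f → 2 ≤ g → g ≤ 2 * i + 1 + e → g ≤ 2 * j + ⟦ b ⟧ + f →
          g * g < 4 * slack b i e j f ⊎
          (g ≡ 3 × b ≡ true × i ≡ 1 × e ≡ 0 × j ≡ 1 × f ≡ 0)
slack-> g false i e j f 2≤g g≤p g≤z = inj₁ (begin-strict
  g * g                                       <⟨ *-monoˡ-< g {{>-nonZero (<-≤-trans z<s 2≤g)}} (n<1+n g) ⟩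
  suc g * g                                   ≤⟨ *-mono-≤ (s≤s g≤p) g≤z ⟩
  suc (2 * i + 1 + e) * (2 * j + 0 + f)       ≤⟨ m≤m+n _ _ ⟩
  2 * (suc (2 * i + 1 + e) * (2 * j + 0 + f)) ≤⟨ slack-false-≥ i e j f ⟩
  4 * slack false i e j f                     ∎)
  where open ≤-Reasoning
slack-> g true i e j f 2≤g g≤p g≤z = go g 2≤g (drop i e g≤p) (drop j f g≤z)
  where
  drop : ∀ {g} i e → g ≤ 2 * i + 1 + e → pred g ≤ 2 * i + e
  drop {g} i e le = pred-mono-≤ (subst (g ≤_) (lem i e) le)
    where
    lem : ∀ i e → 2 * i + 1 + e ≡ suc (2 * i + e)
    lem = solve-∀
  go : ∀ g → 2 ≤ g → pred g ≤ 2 * i + e → pred g ≤ 2 * j + f →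
       g * g < 4 * slack true i e j f ⊎
       (g ≡ 3 × true ≡ true × i ≡ 1 × e ≡ 0 × j ≡ 1 × f ≡ 0)
  go 1 (s≤s ()) _ _
  go 2 _ p z = inj₁ (≤-trans (m≤m+n 5 3) (*-monoʳ-≤ 4 (slack-≥2 i e j f p z)))
  go 3 _ p z with slack-≥3 i e j f p z
  ... | inj₁ 3≤ = inj₁ (≤-trans (m≤m+n 10 2) (*-monoʳ-≤ 4 3≤))
  ... | inj₂ eqs = inj₂ (refl , refl , eqs)
  go (suc (suc (suc (suc h)))) _ p z = inj₁ (begin-strict
    (4 + h) * (4 + h)                       <⟨ m≤m+n _ _ ⟩
    suc ((4 + h) * (4 + h)) + (1 + 4 * h + h * h) ≡⟨ lem h ⟩
    2 * ((3 + h) * (3 + h))                 ≤⟨ *-monoʳ-≤ 2 (*-mono-≤ p z) ⟩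
    2 * ((2 * i + e) * (2 * j + f))         ≤⟨ slack-true-≥ i e j f ⟩
    4 * slack true i e j f                  ∎)
    where
    open ≤-Reasoning
    lem : ∀ h → suc ((4 + h) * (4 + h)) + (1 + 4 * h + h * h) ≡ 2 * ((3 + h) * (3 + h))
    lem = solve-∀

-- Sums of two squares and the comparison inequality

private
  cancel-left : ∀ i d b j → suc i + d + b ≤ i + j → suc d + b ≤ j
  cancel-left i d b j le = +-cancelˡ-≤ i _ _ (subst (_≤ i + j) (lem i d b) le)
    where
    lem : ∀ i d b → suc i + d + b ≡ i + (suc d + b)
    lem = solve-∀

  cancel-right : ∀ a d j i → a + (j + d) ≤ i + j → a + d ≤ i
  cancel-right a d j i le = +-cancelʳ-≤ j _ _ (subst (_≤ i + j) (lem a d j) le)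
    where
    lem : ∀ a d j → a + (j + d) ≡ a + d + j
    lem = solve-∀

  squares-below : ∀ i d b f → suc i + d ≡ b ⊎ suc i + d ≡ suc b →
    i * i + (suc d + b + f) * (suc d + b + f) ≤ (suc i + d) * (suc i + d) + b * b →
    i ≡ b × suc d + b + f ≡ suc i + d
  squares-below i d b f (inj₁ refl) le = contradiction le (<⇒≱ (m+n≤o⇒m≤o _ (≤-reflexive (lem i d f))))
    where
    lem : ∀ i d f → suc ((suc i + d) * (suc i + d) + (suc i + d) * (suc i + d)) +
                    (1 + 4 * d + 2 * d * d + 2 * (suc d + (suc i + d)) * f + f * f) ≡
      i * i + (suc d + (suc i + d) + f) * (suc d + (suc i + d) + f)
    lem = solve-∀
  squares-below i zero _ zero (inj₂ refl) le = (sym (+-identityʳ i) , lem i)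
    where
    lem : ∀ i → suc 0 + (i + 0) + 0 ≡ suc i + 0
    lem = solve-∀
  squares-below i zero _ (suc f) (inj₂ refl) le = contradiction le (<⇒≱ (m+n≤o⇒m≤o _ (≤-reflexive (lem i f))))
    where
    lem : ∀ i f → suc ((suc i + 0) * (suc i + 0) + (i + 0) * (i + 0)) +
                    (f * f + 4 * f + 2 + 2 * i * f + 2 * i) ≡
      i * i + (suc 0 + (i + 0) + suc f) * (suc 0 + (i + 0) + suc f)
    lem = solve-∀
  squares-below i (suc d) _ f (inj₂ refl) le = contradiction le (<⇒≱ (m+n≤o⇒m≤o _ (≤-reflexive (lem i d f))))
    where
    lem : ∀ i d f → suc ((suc i + suc d) * (suc i + suc d) + (i + suc d) * (i + suc d)) +
        (2 * d * d + 6 * d + 3 + 2 * (suc (suc d)) * f + 2 * (i + suc d) * f + f * f) ≡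
      i * i + (suc (suc d) + (i + suc d) + f) * (suc (suc d) + (i + suc d) + f)
    lem = solve-∀

  squares-above : ∀ a j d f → a ≡ j + d ⊎ a ≡ suc (j + d) → a < a + d + f →
         a * a + (j + d) * (j + d) < (a + d + f) * (a + d + f) + j * j
  squares-above a j zero f _ a<i = +-mono-<-≤ (*-mono-< a<i a<i) (≤-reflexive (lem j))
    where
    lem : ∀ j → (j + 0) * (j + 0) ≡ j * j
    lem = solve-∀
  squares-above _ j (suc e) f (inj₁ refl) _ = m+n≤o⇒m≤o _ (≤-reflexive (lem j e f))
    where
    lem : ∀ j e f → suc ((j + suc e) * (j + suc e) + (j + suc e) * (j + suc e)) +
        (1 + 4 * e + 2 * e * e + 2 * (j + suc e + suc e) * f + f * f) ≡
      (j + suc e + suc e + f) * (j + suc e + suc e + f) + j * j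
    lem = solve-∀
  squares-above _ j (suc e) f (inj₂ refl) _ = m+n≤o⇒m≤o _ (≤-reflexive (lem j e f))
    where
    lem : ∀ j e f → suc (suc (j + suc e) * suc (j + suc e) + (j + suc e) * (j + suc e)) +
        (3 + 6 * e + 2 * e * e + 2 * (suc (j + suc e) + suc e) * f + f * f) ≡
      (suc (j + suc e) + suc e + f) * (suc (j + suc e) + suc e + f) + j * j
    lem = solve-∀

-- If `i` drops below `a`, then `j` rises above `b` by at least as much; if `i` rises, `j` can fall
-- by at most as much. Either way the squares grow, unless the two numbers are merely exchanged.
-- Written with the deviations `d` and `f`, each case is a polynomial identity with a visible
-- surplus.
balanced-squares : ∀ {a b i j} → a ≡ b ⊎ a ≡ suc b → a + b ≤ i + j →
  i * i + j * j ≤ a * a + b * b → (i ≡ a × j ≡ b) ⊎ (i ≡ b × j ≡ a)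
balanced-squares {a} {b} {i} {j} near sum≤ squares≤ with <-cmp i a
... | tri≈ _ refl _ = inj₁ (refl , ≤-antisym
        (square-cancel-≤ (+-cancelˡ-≤ (a * a) _ _ squares≤)) (+-cancelˡ-≤ a b j sum≤))
  where
  square-cancel-≤ : ∀ {m n} → m * m ≤ n * n → m ≤ n
  square-cancel-≤ {m} {n} le with m ≤? n
  ... | yes m≤n = m≤n
  ... | no m≰n = contradiction le (<⇒≱ (*-mono-< (≰⇒> m≰n) (≰⇒> m≰n)))
... | tri< i<a _ _ with d , refl ← m≤n⇒∃[o]m+o≡n i<a
    with f , refl ← m≤n⇒∃[o]m+o≡n (cancel-left i d b j sum≤)
    = inj₂ (squares-below i d b f near squares≤)
... | tri> _ _ a<i with ≤-total b j
...   | inj₁ b≤j = contradiction squares≤ (<⇒≱ (+-mono-<-≤ (*-mono-< a<i a<i) (*-mono-≤ b≤j b≤j)))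
...   | inj₂ j≤b with d , refl ← m≤n⇒∃[o]m+o≡n j≤b
    with f , refl ← m≤n⇒∃[o]m+o≡n (cancel-right a d j i sum≤)
    = contradiction squares≤ (<⇒≱ (squares-above a j d f near a<i))

-- The identity `lem′` is the source of `g * g`: for a given `x + y`, the bound on the depths grows
-- with the square of the difference, and an unbalanced split constrains the tree less.
star : ∀ y g {x D E i j ε η S} → x ≡ y + g →
  x * suc x ≡ 2 * (D + i * i + ε) → y * suc y ≡ 2 * (E + j * j + η) →
  (x + y) * (x + y) + 2 * (x + y) ≤ 4 * (D + E) + 4 * S →
  4 * ((i * i + j * j) + (ε + η)) ≤ g * g + 4 * S
star y g {D = D} {E} {i} {j} {ε} {η} {S} refl eqX eqY deep = +-cancelˡ-≤ t _ _ (begin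
  t + 4 * ((i * i + j * j) + (ε + η))
    ≤⟨ +-monoˡ-≤ _ deep ⟩
  4 * (D + E) + 4 * S + 4 * ((i * i + j * j) + (ε + η))
    ≡⟨ lem D E (i * i) (j * j) ε η S ⟩
  2 * (2 * (D + i * i + ε)) + 2 * (2 * (E + j * j + η)) + 4 * S
    ≡⟨ cong₂ (λ u w → 2 * u + 2 * w + 4 * S) eqX eqY ⟨
  2 * ((y + g) * suc (y + g)) + 2 * (y * suc y) + 4 * S
    ≡⟨ lem′ y g S ⟩
  t + (g * g + 4 * S) ∎)
  where
  open ≤-Reasoning
  t = (y + g + y) * (y + g + y) + 2 * (y + g + y)
  lem : ∀ D E I J ε η S → 4 * (D + E) + 4 * S + 4 * ((I + J) + (ε + η)) ≡
                          2 * (2 * (D + I + ε)) + 2 * (2 * (E + J + η)) + 4 * S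
  lem = solve-∀
  lem′ : ∀ y g S → 2 * ((y + g) * suc (y + g)) + 2 * (y * suc y) + 4 * S ≡
                   (y + g + y) * (y + g + y) + 2 * (y + g + y) + (g * g + 4 * S)
  lem′ = solve-∀

-- Integrality absorbs the term `g * g` of `star` when `g ≤ 1`.
quarter : ∀ {x y} → 4 * x ≤ 1 + 4 * y → x ≤ y
quarter {x} {y} le with x ≤? y
... | yes x≤y = x≤y
... | no x≰y = contradiction le (<⇒≱ (begin-strict
  1 + 4 * y  <⟨ +-monoˡ-< (4 * y) {1} {4} (m≤m+n 2 2) ⟩
  4 + 4 * y  ≡⟨ *-suc 4 y ⟨
  4 * suc y  ≤⟨ *-monoʳ-≤ 4 (≰⇒> x≰y) ⟩
  4 * x      ∎))
  where open ≤-Reasoning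

-- Balancing a split of a minimal tree

three-unbalanced : ∀ {a b j} → a ≡ b ⊎ a ≡ suc b → 2 * j ≤ 3 →
                   (3 ≡ a × j ≡ b) ⊎ (3 ≡ b × j ≡ a) → ⊥
three-unbalanced near le eqs = <⇒≱ {3} {4} ≤-refl (≤-trans (*-monoʳ-≤ 2 (two near eqs)) le)
  where
  two : ∀ {a b j} → a ≡ b ⊎ a ≡ suc b → (3 ≡ a × j ≡ b) ⊎ (3 ≡ b × j ≡ a) → 2 ≤ j
  two (inj₁ refl) (inj₁ (refl , refl)) = m≤m+n 2 1
  two (inj₁ refl) (inj₂ (refl , refl)) = m≤m+n 2 1
  two (inj₂ refl) (inj₁ (refl , refl)) = ≤-refl
  two (inj₂ refl) (inj₂ (refl , refl)) = m≤m+n 2 2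

-- Moving a branch of s = `suc p` vertices changes the difference g = `suc h` to g - 2s. For 1 ≤ s ≤
-- g - 1 its absolute value is at most g - 2.
transfer-≤ : ∀ p z y {h} → suc p + z ≡ y + suc h → suc p ≤ h →
             z ≤ (suc p + y) + h × suc p + y ≤ z + h
transfer-≤ p z y {h} eq p<h =
  ≤-trans (m≤n+m z p) (≤-trans (≤-reflexive eq′) (+-monoˡ-≤ h (m≤n+m y (suc p)))) ,
  ≤-trans (+-mono-≤ p<h y≤z) (≤-reflexive (+-comm h z))
  where
  eq′ : p + z ≡ y + h
  eq′ = suc-injective (trans eq (+-suc y h))
  y≤z : y ≤ z
  y≤z = +-cancelʳ-≤ h y z (≤-trans (≤-reflexive (sym eq′))
    (≤-trans (+-monoˡ-≤ z (≤-trans (n≤1+n p) p<h)) (≤-reflexive (+-comm h z))))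

-- The number of odd vertices is represented by `twigs≥` and minimality by `deep`. Both are required
-- at all splits, so they survive every move of a branch or of the root.
module Descent {n} {G : SimpleGraph n} {a b : ℕ} (near : a ≡ b ⊎ a ≡ suc b)
  (twigs≥ : ∀ {X Y} → Split G X Y → a + b ≤ twigs X + twigs Y)
  (deep   : ∀ {X Y} → Split G X Y →
    (descendants X + descendants Y) * (descendants X + descendants Y)
      + 2 * (descendants X + descendants Y) ≤
    4 * (depths X + depths Y) + 4 * (a * a + b * b))
  where

  squares : Tree (Fin n) → Tree (Fin n) → ℕ
  squares X Y = twigs X * twigs X + twigs Y * twigs Y

  bound : ∀ {X Y} g → Split G X Y → descendants X ≡ descendants Y + g →
    4 * (squares X Y + (defect X + defect Y)) ≤ g * g + 4 * (a * a + b * b)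
  bound {X} {Y} g s eq =
    star (descendants Y) g {D = depths X} {depths Y} {twigs X} {twigs Y} {defect X} {defect Y}
      {a * a + b * b} eq (depths-defect X) (depths-defect Y) (deep s)

  twigs≡ : ∀ {X Y} → Split G X Y → squares X Y ≤ a * a + b * b →
    (twigs X ≡ a × twigs Y ≡ b) ⊎ (twigs X ≡ b × twigs Y ≡ a)
  twigs≡ s = balanced-squares near (twigs≥ s)

  squares-≥ : ∀ {X Y} → Split G X Y → a * a + b * b ≤ squares X Y
  squares-≥ {X} {Y} s with ≤-total (squares X Y) (a * a + b * b)
  ... | inj₂ le = le
  ... | inj₁ le with twigs≡ s le
  ...   | inj₁ (refl , refl) = ≤-refl
  ...   | inj₂ (refl , refl) = ≤-reflexive (+-comm (a * a) (b * b))

  -- By `bound` and `squares-≥`, all losses together are at most a quarter of `g * g`, and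
  -- `graftSlack P X` is one of them.
  no-heavy-branches : ∀ {P X Y} g → Split G (P ▷ X) Y →
    descendants (P ▷ X) ≡ descendants Y + g → 2 ≤ g →
    g ≤ suc (descendants P) → g ≤ descendants X → ⊥
  no-heavy-branches {P} {X} {Y} g s eq 2≤g g≤p g≤z
    with slack-> g (odd X) (twigs P) (evens P + ⟦ odd P ⟧) (twigs X) (evens X) 2≤g
           (subst (g ≤_) (branch-size P) g≤p) (subst (g ≤_) (descendants-twigs X) g≤z)
  ... | inj₁ large = <⇒≱ large (+-cancelʳ-≤ (4 * squares (P ▷ X) Y) _ _ (begin
    4 * graftSlack P X + 4 * squares (P ▷ X) Y
      ≡⟨ *-distribˡ-+ 4 (graftSlack P X) (squares (P ▷ X) Y) ⟨
    4 * (graftSlack P X + squares (P ▷ X) Y)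
      ≡⟨ cong (4 *_) (+-comm (graftSlack P X) (squares (P ▷ X) Y)) ⟩
    4 * (squares (P ▷ X) Y + graftSlack P X)
      ≤⟨ *-monoʳ-≤ 4 (+-monoʳ-≤ (squares (P ▷ X) Y) slack≤) ⟩
    4 * (squares (P ▷ X) Y + (defect (P ▷ X) + defect Y)) ≤⟨ bound g s eq ⟩
    g * g + 4 * (a * a + b * b)
      ≤⟨ +-monoʳ-≤ (g * g) (*-monoʳ-≤ 4 (squares-≥ s)) ⟩
    g * g + 4 * squares (P ▷ X) Y ∎))
    where
    open ≤-Reasoning
    slack≤ : graftSlack P X ≤ defect (P ▷ X) + defect Y
    slack≤ = ≤-trans (m≤n+m (graftSlack P X) (defect P + defect X)) (m≤m+n _ (defect Y))
  -- Here the slack is 2 and uses up 8 of the 9 units of `g * g`. By `quarter` the numbers of twigs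
  -- must then be `a` and `b`, but one is 3 and the other, with only 3 descendants in `Y`, is at
  -- most 1.
  ... | inj₂ (refl , oX , tP , eP , tX , eX) = three-unbalanced near small
    (subst (λ t → (t ≡ a × twigs Y ≡ b) ⊎ (t ≡ b × twigs Y ≡ a)) three
      (twigs≡ s (quarter (+-cancelˡ-≤ 8 _ _ (begin
    8 + 4 * squares (P ▷ X) Y
      ≡⟨ lem (squares (P ▷ X) Y) ⟩
    4 * (squares (P ▷ X) Y + 2)
      ≤⟨ *-monoʳ-≤ 4 (+-monoʳ-≤ (squares (P ▷ X) Y) 2≤) ⟩
    4 * (squares (P ▷ X) Y + (defect (P ▷ X) + defect Y)) ≤⟨ bound 3 s eq ⟩
    9 + 4 * (a * a + b * b) ∎)))))
    where
    open ≤-Reasoning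
    lem : ∀ q → 8 + 4 * q ≡ 4 * (q + 2)
    lem = solve-∀
    slack≡ : graftSlack P X ≡ 2
    slack≡ rewrite oX | tP | eP | tX | eX = refl
    2≤ : 2 ≤ defect (P ▷ X) + defect Y
    2≤ = ≤-trans (≤-reflexive (sym slack≡))
      (≤-trans (m≤n+m (graftSlack P X) (defect P + defect X)) (m≤m+n _ (defect Y)))
    three : twigs (P ▷ X) ≡ 3
    three rewrite oX | tP | tX = refl
    desc≡ : descendants Y ≡ 3
    desc≡ = +-cancelʳ-≡ 3 (descendants Y) 3 (trans (sym eq) (cong₂ _+_
      (trans (branch-size P) (cong₂ (λ i e → 2 * i + 1 + e) tP eP))
      (trans (descendants-twigs X)
        (trans (cong₂ (λ i o → 2 * i + ⟦ o ⟧ + evens X) tX oX) (cong (3 +_) eX)))))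
    small : 2 * twigs Y ≤ 3
    small = ≤-trans (m≤m+n _ (⟦ odd Y ⟧ + evens Y)) (≤-reflexive
      (trans (sym (+-assoc (2 * twigs Y) _ _)) (trans (sym (descendants-twigs Y)) desc≡)))
  record Balanced : Set where
    constructor balanced
    field
      {left right} : Tree (Fin n)
      gap   : ℕ
      gap≤1 : gap ≤ 1
      sizes : descendants left ≡ descendants right + gap
      split : Split G left right

  -- `m` is fuel, since each move lowers the gap, and `retry` puts the heavier side first again. One
  -- of the first two branches changes sides if it has fewer than `g` vertices; a sole branch with
  -- at least `g` vertices receives the root instead; two such branches contradict
  -- `no-heavy-branches`.
  descend : ∀ m {X Y} g → g ≤ m → descendants X ≡ descendants Y + g → Split G X Y → Balanced
  retry : ∀ m h {X Y} → h ≤ m → descendants X ≤ descendants Y + h →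
          descendants Y ≤ descendants X + h → Split G X Y → Balanced

  descend m 0 _ eq s = balanced 0 z≤n eq s
  descend m 1 _ eq s = balanced 1 ≤-refl eq s
  descend (suc m) {leaf v} {Y} (suc (suc h)) _ eq s
    with () ← trans eq (+-suc (descendants Y) (suc h))
  descend (suc m) {P ▷ X} {Y} (suc (suc h)) (s≤s h≤m) eq s
    with suc (descendants P) <? suc (suc h) | X
  ... | yes (s≤s p<g) | X =
    let le , le′ = transfer-≤ (descendants P) (descendants X) (descendants Y) eq p<g
    in retry m (suc h) h≤m le le′ (move-branch P s)
  -- The root moves into the only branch. The heavier side loses one vertex and the other gains one,
  -- so the gap falls by two, to `h`.
  ... | no p≮g | leaf v = retry m (suc h) h≤m
    (≤-trans (≤-reflexive eq′) (+-monoˡ-≤ (suc h) (≤-trans (n≤1+n _) (≤-reflexive (sym (+-identityʳ _))))))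
    (≤-trans (≤-reflexive (+-comm (suc (descendants Y)) 0)) (≤-trans
      (subst (suc (descendants Y) ≤_) (sym (trans eq′ (+-suc (descendants Y) h))) (s≤s (m≤m+n _ h)))
      (m≤m+n _ (suc h))))
    (move-root P s)
    where
    eq′ : descendants P ≡ descendants Y + suc h
    eq′ = suc-injective (trans (sym (+-identityʳ _)) (trans eq (+-suc (descendants Y) (suc h))))
  ... | no p≮g | P′ ▷ X′ with suc (descendants P′) <? suc (suc h)
  ...   | yes (s≤s p<g) =
    let le , le′ = transfer-≤ (descendants P′) (descendants (P ▷ X′)) (descendants Y)
                     (trans (exchange (suc (descendants P′)) (suc (descendants P)) (descendants X′)) eq) p<g
    in retry m (suc h) h≤m le le′ (move-second-branch P P′ s)
    where
    exchange : ∀ p q x → p + (q + x) ≡ q + (p + x)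
    exchange = solve-∀
  ...   | no p′≮g = contradiction (≤-trans (≮⇒≥ p′≮g) (m≤m+n _ _))
    (no-heavy-branches (suc (suc h)) s eq (s≤s (s≤s z≤n)) (≮⇒≥ p≮g))

  retry m h {X} {Y} h≤m X≤ Y≤ s with ≤-total (descendants X) (descendants Y)
  ... | inj₂ Y≤X with g , eq ← m≤n⇒∃[o]m+o≡n Y≤X =
    descend m g (≤-trans (+-cancelˡ-≤ (descendants Y) g h (subst (_≤ _) (sym eq) X≤)) h≤m) (sym eq) s
  ... | inj₁ X≤Y with g , eq ← m≤n⇒∃[o]m+o≡n X≤Y =
    descend m g (≤-trans (+-cancelˡ-≤ (descendants X) g h (subst (_≤ _) (sym eq) Y≤)) h≤m) (sym eq) (split-sym s)

  -- The squares alone already reach `a * a + b * b` by `squares-≥`, so nothing remains for the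
  -- defects.
  tight : ∀ {X Y} g → g ≤ 1 → descendants X ≡ descendants Y + g → Split G X Y →
          squares X Y ≤ a * a + b * b × defect X ≡ 0 × defect Y ≡ 0
  tight {X} {Y} g g≤1 sizes s =
    m+n≤o⇒m≤o (squares X Y) total , m+n≡0⇒m≡0 (defect X) no-defect , m+n≡0⇒n≡0 (defect X) no-defect
    where
    total : squares X Y + (defect X + defect Y) ≤ a * a + b * b
    total = quarter (≤-trans (bound g s sizes) (+-monoˡ-≤ _ (*-mono-≤ g≤1 g≤1)))
    no-defect : defect X + defect Y ≡ 0
    no-defect = n≤0⇒n≡0 (+-cancelˡ-≤ (squares X Y) _ _
      (≤-trans total (≤-trans (squares-≥ s) (≤-reflexive (sym (+-identityʳ _))))))

  canonical : ∀ {X Y} → Split G X Y →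
    ∃ λ r → ∃₂ λ X′ Y′ → Caterpillar 0 a X′ × Caterpillar r b Y′ × Split G X′ Y′
  canonical {X} {Y} s = finish (start (≤-total (descendants X) (descendants Y)))
    where
    start : descendants X ≤ descendants Y ⊎ descendants Y ≤ descendants X → Balanced
    start (inj₂ Y≤X) with g , eq ← m≤n⇒∃[o]m+o≡n Y≤X = descend g g ≤-refl (sym eq) s
    start (inj₁ X≤Y) with g , eq ← m≤n⇒∃[o]m+o≡n X≤Y = descend g g ≤-refl (sym eq) (split-sym s)
    -- All of the stem of `X` is handed to `Y`. The root then lies where the comb with `a` teeth
    -- begins, which fixes the shape up to the length of the one remaining stem.
    unstem : ∀ {i j X Y} → Caterpillar i a X → Caterpillar j b Y → Split G X Y →
      ∃ λ r → ∃₂ λ X′ Y′ → Caterpillar 0 a X′ × Caterpillar r b Y′ × Split G X′ Y′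
    unstem {i} {j} {X} cX cY s
      with Y′ , X′ , cY′ , cX′ , s′ ← slide i cY
             (subst (λ m → Caterpillar m a X) (sym (+-identityʳ i)) cX) (split-sym s)
      = i + j , X′ , Y′ , cX′ , cY′ , split-sym s′
    finish : Balanced → _
    finish (balanced {X} {Y} g g≤1 sizes s)
      with sq , dX , dY ← tight g g≤1 sizes s
      with i , X′ , X≈X′ , cX ← defect≡0⇒caterpillar X dX
      with j , Y′ , Y≈Y′ , cY ← defect≡0⇒caterpillar Y dY
      = go (twigs≡ s sq)
      where
      go : (twigs X ≡ a × twigs Y ≡ b) ⊎ (twigs X ≡ b × twigs Y ≡ a) → _
      go (inj₁ (p , q)) = unstem
        (subst (λ t → Caterpillar i t X′) p cX) (subst (λ t → Caterpillar j t Y′) q cY)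
        (split-≈ X≈X′ Y≈Y′ s)
      go (inj₂ (p , q)) = unstem
        (subst (λ t → Caterpillar j t Y′) q cY) (subst (λ t → Caterpillar i t X′) p cX)
        (split-sym (split-≈ X≈X′ Y≈Y′ s))

-- Growing a spanning tree

module _ {V : Set} where

  vertices-▷⁻ : ∀ (Y Z : Tree V) {v} → v ∈ vertices (Y ▷ Z) → v ∈ vertices Y ⊎ v ∈ vertices Z
  vertices-▷⁻ Y Z v∈ = ∈-++⁻ (vertices Y) (∈-resp-↭ (vertices-▷ Y Z) v∈)

  insert : ∀ (t : Tree V) {u} w → u ∈ vertices t → ∃ λ t′ → root t′ ≡ root t ×
    vertices t′ ↭ w ∷ vertices t × arcs t′ ↭ (w , u) ∷ (u , w) ∷ arcs t
  insert (leaf u) w (here refl) = leaf w ▷ leaf u , refl , ↭-swap u w ↭-refl , ↭-refl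
  insert (Y ▷ Z) {u} w u∈ with vertices-▷⁻ Y Z u∈
  ... | inj₁ u∈Y with Y′ , r , vs , as ← insert Y w u∈Y = Y′ ▷ Z , refl ,
    ↭-trans (vertices-▷ Y′ Z)
      (↭-trans (++⁺ʳ (vertices Z) vs) (prep w (↭-sym (vertices-▷ Y Z)))) ,
    subst (λ v → (v , root Z) ∷ (root Z , v) ∷ arcs Y′ ++ arcs Z ↭
                 (w , u) ∷ (u , w) ∷ arcs (Y ▷ Z)) (sym r)
      (↭-trans (prep _ (prep _ (++⁺ʳ (arcs Z) as)))
        (shifts ((root Y , root Z) ∷ (root Z , root Y) ∷ []) ((w , u) ∷ (u , w) ∷ [])))
  ... | inj₂ u∈Z with Z′ , r , vs , as ← insert Z w u∈Z = Y ▷ Z′ , r ,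
    ↭-trans (vertices-▷ Y Z′)
      (↭-trans (++⁺ˡ (vertices Y) vs)
        (↭-trans (shift w (vertices Y) (vertices Z)) (prep w (↭-sym (vertices-▷ Y Z))))) ,
    subst (λ v → (root Y , v) ∷ (v , root Y) ∷ arcs Y ++ arcs Z′ ↭
                 (w , u) ∷ (u , w) ∷ arcs (Y ▷ Z)) (sym r)
      (↭-trans (prep _ (prep _ (++⁺ˡ (arcs Y) as)))
        (shifts ((root Y , root Z) ∷ (root Z , root Y) ∷ arcs Y) ((w , u) ∷ (u , w) ∷ [])))

record Subtree {n} (G : SimpleGraph n) (t : Tree (Fin n)) : Set where
  constructor mkSubtree
  field
    unique  : Unique (vertices t)
    arc⇒adj : ∀ {u v} → (u , v) ∈ arcs t → Adj G u v

module _ {n} {G : SimpleGraph n} where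

  open DecMembership (Fin._≟_ {n}) using (_∈?_)

  attach : ∀ {t t′ u w} → Subtree G t → Adj G u w → w ∉ vertices t →
    vertices t′ ↭ w ∷ vertices t → arcs t′ ↭ (w , u) ∷ (u , w) ∷ arcs t → Subtree G t′
  attach {t} {t′} {u} {w} s uw w∉ vs as = mkSubtree
    (unique-resp-↭ (↭-sym vs) (All.¬Any⇒All¬ _ w∉ ∷ Subtree.unique s))
    (λ a → adjacent (∈-resp-↭ as a))
    where
    adjacent : ∀ {x y} → (x , y) ∈ (w , u) ∷ (u , w) ∷ arcs t → Adj G x y
    adjacent (here refl) = adj-sym G uw
    adjacent (there (here refl)) = uw
    adjacent (there (there a)) = Subtree.arc⇒adj s a

  extend : ∀ {ℓ u v t} → Walk G ℓ u v → Subtree G t → u ∈ vertices t →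
           ∃ λ t′ → Subtree G t′ × vertices t ⊆ vertices t′ × v ∈ vertices t′
  extend {zero} refl s u∈ = _ , s , (λ v∈ → v∈) , u∈
  extend {suc ℓ} {u} {v} {t} (w , uw , wv) s u∈ with w ∈? vertices t
  ... | yes w∈ = extend wv s w∈
  ... | no w∉
    with t₁ , _ , vs , as ← insert t w u∈
    with t′ , s′ , t₁⊆ , v∈ ← extend wv
           (attach {t} {t₁} s uw w∉ vs as)
           (∈-resp-↭ (↭-sym vs) (here refl))
    = t′ , s′ , (λ x∈ → t₁⊆ (∈-resp-↭ (↭-sym vs) (there x∈))) , v∈

  cover : Connected G → ∀ vs {t} → Subtree G t →
          ∃ λ t′ → Subtree G t′ × vertices t ⊆ vertices t′ × vs ⊆ vertices t′
  cover conn [] s = _ , s , (λ v∈ → v∈) , λ ()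
  cover conn (v ∷ vs) {t} s
    with t₁ , s₁ , t⊆ , vs⊆ ← cover conn vs s
    with t′ , s′ , t₁⊆ , v∈ ← extend (proj₂ (conn (root t₁) v)) s₁ (root∈ t₁)
    = t′ , s′ , (λ x∈ → t₁⊆ (t⊆ x∈)) ,
      λ { (here refl) → v∈ ; (there x∈) → t₁⊆ (vs⊆ x∈) }

-- Paths

data Chain {V : Set} (R : V → V → Set) : V → V → List V → Set where
  stop : ∀ {v} → Chain R v v (v ∷ [])
  step : ∀ {u v w xs} → R u w → Chain R w v xs → Chain R u v (u ∷ xs)

module _ {V : Set} where

  chain-map : ∀ {R S : V → V → Set} → (∀ {u v} → R u v → S u v) →
              ∀ {u v xs} → Chain R u v xs → Chain S u v xs
  chain-map f stop = stop
  chain-map f (step r c) = step (f r) (chain-map f c)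

  chain-++ : ∀ {R : V → V → Set} {u v w x xs ys} →
             Chain R u v xs → R v w → Chain R w x ys → Chain R u x (xs ++ ys)
  chain-++ stop r d = step r d
  chain-++ (step r′ c) r d = step r′ (chain-++ c r d)

  chain-last : ∀ {R : V → V → Set} {u v x xs} → Chain R u v (x ∷ xs) →
               lookup (x ∷ xs) (fromℕ (length xs)) ≡ v
  chain-last stop = refl
  chain-last (step _ c@stop) = chain-last c
  chain-last (step _ c@(step _ _)) = chain-last c

  chain-steps : ∀ {R : V → V → Set} {u v x xs} → Chain R u v (x ∷ xs) →
    ∀ i → R (lookup (x ∷ xs) (inject₁ i)) (lookup (x ∷ xs) (suc i))
  chain-steps (step r stop) zero = r
  chain-steps (step r (step _ _)) zero = r
  chain-steps (step _ c@(step _ _)) (suc i) = chain-steps c i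

  lookup-injective : ∀ {xs : List V} → Unique xs → ∀ {i j} → lookup xs i ≡ lookup xs j → i ≡ j
  lookup-injective (_ ∷ _) {zero} {zero} _ = refl
  lookup-injective {x ∷ xs} (x∉ ∷ _) {zero} {suc j} eq = contradiction eq (All.lookup x∉ (∈-lookup j))
  lookup-injective {x ∷ xs} (x∉ ∷ _) {suc i} {zero} eq = contradiction (sym eq) (All.lookup x∉ (∈-lookup i))
  lookup-injective (_ ∷ u) {suc i} {suc j} eq = cong suc (lookup-injective u eq)

  Arc : Tree V → V → V → Set
  Arc t u v = (u , v) ∈ arcs t

  path : ∀ (t : Tree V) {u v} → Unique (vertices t) → u ∈ vertices t → v ∈ vertices t →
         ∃ λ xs → Chain (Arc t) u v xs × Unique xs × xs ⊆ vertices t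
  path (leaf v) _ (here refl) (here refl) = _ , stop , [] ∷ [] , λ x∈ → x∈
  path (Y ▷ Z) un u∈ v∈ with uY , uZ , Y#Z ← unique-▷ Y Z un
    with vertices-▷⁻ Y Z u∈ | vertices-▷⁻ Y Z v∈
  ... | inj₁ u∈Y | inj₁ v∈Y with xs , c , uxs , xs⊆ ← path Y uY u∈Y v∈Y =
    xs , chain-map (arc-▷⁺ˡ {Y = Y} {Z}) c , uxs , λ x∈ → vertices-▷⁺ˡ {Y = Y} {Z} (xs⊆ x∈)
  ... | inj₂ u∈Z | inj₂ v∈Z with xs , c , uxs , xs⊆ ← path Z uZ u∈Z v∈Z =
    xs , chain-map (arc-▷⁺ʳ {Y = Y} {Z}) c , uxs , λ x∈ → vertices-▷⁺ʳ {Y = Y} {Z} (xs⊆ x∈)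
  ... | inj₁ u∈Y | inj₂ v∈Z
    with xs , c , uxs , xs⊆ ← path Y uY u∈Y (root∈ Y)
    with ys , d , uys , ys⊆ ← path Z uZ (root∈ Z) v∈Z =
    xs ++ ys ,
    chain-++ (chain-map (arc-▷⁺ˡ {Y = Y} {Z}) c) (here refl) (chain-map (arc-▷⁺ʳ {Y = Y} {Z}) d) ,
    Unique.++⁺ uxs uys (λ (x∈ , y∈) → Y#Z (xs⊆ x∈ , ys⊆ y∈)) ,
    λ x∈ → [ (λ x∈′ → vertices-▷⁺ˡ {Y = Y} {Z} (xs⊆ x∈′))
           , (λ x∈′ → vertices-▷⁺ʳ {Y = Y} {Z} (ys⊆ x∈′)) ]′ (∈-++⁻ xs x∈)
  ... | inj₂ u∈Z | inj₁ v∈Y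
    with xs , c , uxs , xs⊆ ← path Z uZ u∈Z (root∈ Z)
    with ys , d , uys , ys⊆ ← path Y uY (root∈ Y) v∈Y =
    xs ++ ys ,
    chain-++ (chain-map (arc-▷⁺ʳ {Y = Y} {Z}) c) (there (here refl)) (chain-map (arc-▷⁺ˡ {Y = Y} {Z}) d) ,
    Unique.++⁺ uxs uys (λ (x∈ , y∈) → Y#Z (ys⊆ y∈ , xs⊆ x∈)) ,
    λ x∈ → [ (λ x∈′ → vertices-▷⁺ʳ {Y = Y} {Z} (xs⊆ x∈′))
           , (λ x∈′ → vertices-▷⁺ˡ {Y = Y} {Z} (ys⊆ x∈′)) ]′ (∈-++⁻ xs x∈)

-- Trees and splits

module _ {n} {G : SimpleGraph n} where

  chain⇒walk : ∀ {u v xs} → Chain (Adj G) u v xs → ∃ λ ℓ → Walk G ℓ u v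
  chain⇒walk stop = 0 , refl
  chain⇒walk (step uw c) with ℓ , wv ← chain⇒walk c = suc ℓ , _ , uw , wv

  walk-trans : ∀ {ℓ m u v w} → Walk G ℓ u v → Walk G m v w → ∃ λ k → Walk G k u w
  walk-trans {zero} refl d = _ , d
  walk-trans {suc ℓ} (x , ux , xv) d with k , xw ← walk-trans xv d = suc k , x , ux , xw

  -- If the path from `u` to `v` in `t` had at least two edges, the edge `uv` would close it to a
  -- cycle.
  subtree-complete : ¬ Cycle G → ∀ {t} → Subtree G t → ∀ {u v} →
    u ∈ vertices t → v ∈ vertices t → Adj G u v → (u , v) ∈ arcs t
  subtree-complete acyclic {t} s {u} {v} u∈ v∈ uv
    with path t (Subtree.unique s) u∈ v∈
  ... | _ , stop , _ = contradiction uv (adj-irrefl G refl)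
  ... | _ , step a stop , _ = a
  ... | u ∷ x ∷ y ∷ zs , c@(step _ (step _ _)) , uxs , _ = contradiction cycle acyclic
    where
    cycle : Cycle G
    cycle = record
      { excess   = length zs
      ; vertex   = lookup (u ∷ x ∷ y ∷ zs)
      ; distinct = lookup-injective uxs
      ; steps    = λ i → Subtree.arc⇒adj s (chain-steps c i)
      ; closing  = subst (λ w → Adj G w u) (sym (chain-last c)) (adj-sym G uv)
      }

  -- One side is a bare root. No balance is required of the split with which the descent begins.
  tree⇒split : IsTree G → Fin n → ∃₂ (Split G)
  tree⇒split T c
    with t , s , _ , all ← cover {G = G} (IsTree.connected T) (allFin n) {leaf c}
           (mkSubtree ([] ∷ []) λ ())
    = leaf (root t) , t , mkSplit refl
        (unique∧set⇒↭ (Subtree.unique s) (Unique.allFin⁺ n)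
          (mk⇔ (λ _ → ∈-allFin _) (λ _ → all (∈-allFin _))))
        (subtree-complete (IsTree.acyclic T) s (all (∈-allFin _)) (all (∈-allFin _)))
        (Subtree.arc⇒adj s)

  hangs-walk : ∀ {t u v} → Hangs G t → u ∈ vertices t → v ∈ vertices t → ∃ λ ℓ → Walk G ℓ u v
  hangs-walk {t} h u∈ v∈ with _ , c , _ ← path t (Hangs.unique h) u∈ v∈ =
    chain⇒walk (chain-map (Hangs.arc⇒adj h) c)

  split-side : ∀ {X Y} → Split G X Y → ∀ w → w ∈ vertices X ⊎ w ∈ vertices Y
  split-side {X} s w = [ inj₁ , (λ w∈ → inj₂ (there w∈)) ]′
    (∈-++⁻ (vertices X) (∈-resp-↭ (↭-sym (Split.exhaust s)) (∈-allFin w)))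

  split⇒connected : ∀ {X Y} → Split G X Y → Connected G
  split⇒connected {X} {Y} s u v with split-side s u | split-side s v
  ... | inj₁ u∈ | inj₁ v∈ = hangs-walk (split-hangsˡ s) u∈ v∈
  ... | inj₂ u∈ | inj₂ v∈ = hangs-walk (split-hangsʳ s) u∈ v∈
  ... | inj₁ u∈ | inj₂ v∈ =
    walk-trans (proj₂ (hangs-walk (split-hangsˡ s) u∈ (here (sym (Split.roots≡ s)))))
               (proj₂ (hangs-walk (split-hangsʳ s) (root∈ Y) v∈))
  ... | inj₂ u∈ | inj₁ v∈ =
    walk-trans (proj₂ (hangs-walk (split-hangsʳ s) u∈ (root∈ Y)))
               (proj₂ (hangs-walk (split-hangsˡ s) (here (sym (Split.roots≡ s))) v∈))

  arc⇒branch : ∀ t → Hangs G t → ∀ {u v} → (u , v) ∈ arcs t →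
    ∃₂ λ Y p → Branch G Y p × ((u ≡ root Y × v ≡ p) ⊎ (u ≡ p × v ≡ root Y))
  arc⇒branch (Y ▷ Z) h a with b , hZ ← hangs-▷ h with arc-▷⁻ Y Z a
  ... | inj₁ eqs = Y , root Z , b , inj₁ eqs
  ... | inj₂ (inj₁ eqs) = Y , root Z , b , inj₂ eqs
  ... | inj₂ (inj₂ (inj₁ a′)) = arc⇒branch Y (branch⇒hangs b) a′
  ... | inj₂ (inj₂ (inj₂ a′)) = arc⇒branch Z hZ a′

  -- Having used the bridge in its first step, the cycle cannot change sides before it closes, as
  -- this would revisit vertex 0. So the closing edge crosses, and the last vertex would have to be
  -- vertex 1.
  bridge-off-cycle : Connected G → (c : Cycle G) → ∀ {Y p} → Branch G Y p →
    ¬ ((Cycle.vertex c zero ≡ root Y × Cycle.vertex c (suc zero) ≡ p) ⊎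
       (Cycle.vertex c zero ≡ p × Cycle.vertex c (suc zero) ≡ root Y))
  bridge-off-cycle conn c {Y} {p} b = λ
    { (inj₁ (eq₀ , eq₁)) →
        let outside = <-weakInduction (λ i → vertex (suc i) ∉ vertices Y)
              (subst (_∉ vertices Y) (sym eq₁) (Branch.outside b))
              (λ j out inn → contradiction
                (distinct (trans (proj₁ (crossing inn out (adj-sym G (steps (suc j))))) (sym eq₀)))
                λ ())
        in contradiction
             (distinct (trans (proj₂ (crossing (subst (_∈ vertices Y) (sym eq₀) (root∈ Y))
                                               (outside (fromℕ (suc excess))) (adj-sym G closing)))
                              (sym eq₁)))
             λ ()
    ; (inj₂ (eq₀ , eq₁)) →
        let inside = <-weakInduction (λ i → vertex (suc i) ∈ vertices Y)
              (subst (_∈ vertices Y) (sym eq₁) (root∈ Y))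
              (λ j inn → decidable-stable (_ ∈? vertices Y) λ out → contradiction
                (distinct (trans (proj₂ (crossing inn out (steps (suc j)))) (sym eq₀)))
                λ ())
        in contradiction
             (distinct (trans (proj₁ (crossing (inside (fromℕ (suc excess)))
                                               (subst (_∉ vertices Y) (sym eq₀) (Branch.outside b)) closing))
                              (sym eq₁)))
             λ ()
    }
    where
    open Cycle c
    open DecMembership (Fin._≟_ {n}) using (_∈?_)
    crossing : ∀ {u v} → u ∈ vertices Y → v ∉ vertices Y → Adj G u v → u ≡ root Y × v ≡ p
    crossing = branch-crossing conn b

  split⇒tree : ∀ {X Y} → Split G X Y → IsTree G
  split⇒tree {X} {Y} s = record { connected = conn ; acyclic = acyclic }
    where
    conn = split⇒connected s
    acyclic : ¬ Cycle G
    acyclic c with ∈-++⁻ (arcs X) (Split.adj⇒arc s (Cycle.steps c zero))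
    ... | inj₁ a with _ , _ , b , eqs ← arc⇒branch X (split-hangsˡ s) a = bridge-off-cycle conn c b eqs
    ... | inj₂ a with _ , _ , b , eqs ← arc⇒branch Y (split-hangsʳ s) a = bridge-off-cycle conn c b eqs

-- Isomorphism of trees of the same shape

data SameShape {V : Set} : Tree V → Tree V → Set where
  leaf : ∀ {v w} → SameShape (leaf v) (leaf w)
  _▷_  : ∀ {Y Y′ Z Z′} → SameShape Y Y′ → SameShape Z Z′ → SameShape (Y ▷ Z) (Y′ ▷ Z′)

module _ {V : Set} where

  comb-shape : ∀ {q} {F F′ : Tree V} → Comb q F → Comb q F′ → SameShape F F′
  comb-shape tip tip = leaf
  comb-shape (tooth c) (tooth c′) = leaf ▷ comb-shape c c′ ▷ leaf

  caterpillar-shape : ∀ {j q} {F F′ : Tree V} →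
                      Caterpillar j q F → Caterpillar j q F′ → SameShape F F′
  caterpillar-shape (comb c) (comb c′) = comb-shape c c′
  caterpillar-shape (stem c) (stem c′) = caterpillar-shape c c′ ▷ leaf

  same-descendants : ∀ {X X′ : Tree V} → SameShape X X′ → descendants X ≡ descendants X′
  same-descendants leaf = refl
  same-descendants (s ▷ s′) = cong₂ (λ y z → suc y + z) (same-descendants s) (same-descendants s′)

  ++-split : ∀ (xs xs′ : List V) {ys ys′} → length xs ≡ length xs′ →
             xs ++ ys ≡ xs′ ++ ys′ → xs ≡ xs′ × ys ≡ ys′
  ++-split [] [] _ eq = refl , eq
  ++-split (x ∷ xs) (x′ ∷ xs′) len eq with refl , eq′ ← ∷-injective eq
    with refl , eq″ ← ++-split xs xs′ (suc-injective len) eq′ = refl , eq″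

  relabel-++ : ∀ (f : V → V) {X X′ : Tree V} {ys ys′} → SameShape X X′ →
    map f (below X ++ ys) ≡ below X′ ++ ys′ → map f (below X) ≡ below X′ × map f ys ≡ ys′
  relabel-++ f {X} {X′} {ys} same eq = ++-split (map f (below X)) (below X′)
    (trans (length-map f (below X)) (trans (length-below X)
      (trans (same-descendants same) (sym (length-below X′)))))
    (trans (sym (map-++ f (below X) ys)) eq)

  relabel-arcs : ∀ (f : V → V) {X X′ : Tree V} → SameShape X X′ →
    f (root X) ≡ root X′ → map f (below X) ≡ below X′ →
    map (Product.map f f) (arcs X) ≡ arcs X′
  relabel-arcs f leaf _ _ = refl
  relabel-arcs f {Y ▷ Z} {Y′ ▷ Z′} (s ▷ s′) r eq
    with rY , eq′ ← ∷-injective eq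
    with bY , bZ ← relabel-++ f s eq′ =
    cong₂ _∷_ (cong₂ _,_ rY r) (cong₂ _∷_ (cong₂ _,_ r rY)
      (trans (map-++ (Product.map f f) (arcs Y) (arcs Z))
             (cong₂ _++_ (relabel-arcs f s rY bY) (relabel-arcs f s′ r bZ))))

module _ {n : ℕ} where

  relabelling : (xs ys : List (Fin n)) → Unique xs → length xs ≡ length ys →
                ∃ λ f → map f xs ≡ ys
  relabelling [] [] _ _ = (λ v → v) , refl
  relabelling (x ∷ xs) (y ∷ ys) (x∉ ∷ u) len with f , eq ← relabelling xs ys u (suc-injective len) =
    g , cong₂ _∷_ g-x (trans (g-xs xs x∉) eq)
    where
    g : Fin n → Fin n
    g v with v Fin.≟ x
    ... | yes _ = y
    ... | no  _ = f v
    g-x : g x ≡ y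
    g-x with x Fin.≟ x
    ... | yes _ = refl
    ... | no x≢x = contradiction refl x≢x
    g-xs : ∀ zs → All (x ≢_) zs → map g zs ≡ map f zs
    g-xs [] [] = refl
    g-xs (z ∷ zs) (x≢z ∷ x∉) with z Fin.≟ x
    ... | yes refl = contradiction refl x≢z
    ... | no _ = cong (f z ∷_) (g-xs zs x∉)

map-injective-on : ∀ {A B : Set} {f : A → B} {xs} → Unique (map f xs) →
                   ∀ {x y} → x ∈ xs → y ∈ xs → f x ≡ f y → x ≡ y
map-injective-on _ (here refl) (here refl) _ = refl
map-injective-on {f = f} (x∉ ∷ _) (here refl) (there y∈) eq =
  contradiction eq (All.lookup x∉ (∈-map⁺ f y∈))
map-injective-on {f = f} (x∉ ∷ _) (there x∈) (here refl) eq =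
  contradiction (sym eq) (All.lookup x∉ (∈-map⁺ f x∈))
map-injective-on (_ ∷ u) (there x∈) (there y∈) eq = map-injective-on u x∈ y∈ eq

module _ {n} {G H : SimpleGraph n} where

  -- The vertex lists are matched position by position. Equal shapes list their vertices and arcs in
  -- the same order, so the matching carries one list of arcs to the other.
  split-≅ : ∀ {X Y X′ Y′} → SameShape X X′ → SameShape Y Y′ →
            Split G X Y → Split H X′ Y′ → G ≅ H
  split-≅ {X} {Y} {X′} {Y′} sX sY s s′
    with f , eq ← relabelling (root X ∷ below X ++ below Y) (root X′ ∷ below X′ ++ below Y′)
           (split-unique s) (trans (↭-length (Split.exhaust s)) (sym (↭-length (Split.exhaust s′))))
    with r , eq′ ← ∷-injective eq
    with bX , bY ← relabel-++ f sX eq′ =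
    mk⤖ {to = f} (injective , surjective) , λ u v → mk⇔ (to u v) (from u v)
    where
    everywhere : ∀ v → v ∈ root X ∷ below X ++ below Y
    everywhere v = ∈-resp-↭ (↭-sym (Split.exhaust s)) (∈-allFin v)
    injective : ∀ {u v} → f u ≡ f v → u ≡ v
    injective {u} {v} = map-injective-on (subst Unique (sym eq) (split-unique s′))
                          (everywhere u) (everywhere v)
    surjective : ∀ v → ∃ λ u → ∀ {w} → w ≡ u → f w ≡ v
    surjective v
      with u , _ , refl ← ∈-map⁻ f (subst (v ∈_) (sym eq) (∈-resp-↭ (↭-sym (Split.exhaust s′)) (∈-allFin v)))
      = u , λ { refl → refl }
    arcs≡ : map (Product.map f f) (arcs X ++ arcs Y) ≡ arcs X′ ++ arcs Y′
    arcs≡ = trans (map-++ (Product.map f f) (arcs X) (arcs Y))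
      (cong₂ _++_ (relabel-arcs f sX r bX)
                  (relabel-arcs f sY (trans (cong f (sym (Split.roots≡ s))) (trans r (Split.roots≡ s′))) bY))
    to : ∀ u v → Adj G u v → Adj H (f u) (f v)
    to u v uv = Split.arc⇒adj s′ (subst (_ ∈_) arcs≡ (∈-map⁺ (Product.map f f) (Split.adj⇒arc s uv)))
    from : ∀ u v → Adj H (f u) (f v) → Adj G u v
    from u v uv
      with (u′ , v′) , a , eqs ← ∈-map⁻ (Product.map f f) (subst (_ ∈_) (sym arcs≡) (Split.adj⇒arc s′ uv))
      = subst₂ (Adj G) (sym (injective (cong proj₁ eqs))) (sym (injective (cong proj₂ eqs)))
          (Split.arc⇒adj s a)

-- `C n a b` as a split

module _ {V W : Set} (f : V → W) where

  mapTree : Tree V → Tree W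
  mapTree (leaf v) = leaf (f v)
  mapTree (Y ▷ Z)  = mapTree Y ▷ mapTree Z

  root-map : ∀ t → root (mapTree t) ≡ f (root t)
  root-map (leaf v) = refl
  root-map (Y ▷ Z)  = root-map Z

  below-map : ∀ t → below (mapTree t) ≡ map f (below t)
  below-map (leaf v) = refl
  below-map (Y ▷ Z) = cong₂ _∷_ (root-map Y)
    (trans (cong₂ _++_ (below-map Y) (below-map Z)) (sym (map-++ f (below Y) (below Z))))

  arcs-map : ∀ t → arcs (mapTree t) ≡ map (Product.map f f) (arcs t)
  arcs-map (leaf v) = refl
  arcs-map (Y ▷ Z) rewrite root-map Y | root-map Z =
    cong (λ es → _ ∷ _ ∷ es)
      (trans (cong₂ _++_ (arcs-map Y) (arcs-map Z)) (sym (map-++ (Product.map f f) (arcs Y) (arcs Z))))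

  comb-map : ∀ {q F} → Comb q F → Comb q (mapTree F)
  comb-map tip       = tip
  comb-map (tooth c) = tooth (comb-map c)

  caterpillar-map : ∀ {j q F} → Caterpillar j q F → Caterpillar j q (mapTree F)
  caterpillar-map (comb c) = comb (comb-map c)
  caterpillar-map (stem c) = stem (caterpillar-map c)

interval : ℕ → ℕ → List ℕ
interval s zero    = []
interval s (suc l) = s ∷ interval (suc s) l

interval-++ : ∀ s k l → interval s (k + l) ≡ interval s k ++ interval (s + k) l
interval-++ s zero l = cong (λ t → interval t l) (sym (+-identityʳ s))
interval-++ s (suc k) l = cong (s ∷_) (trans (interval-++ (suc s) k l)
  (cong (λ t → interval (suc s) k ++ interval t l) (sym (+-suc s k))))

interval-∷ʳ : ∀ s l → interval s (suc l) ↭ (s + l) ∷ interval s l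
interval-∷ʳ s l = ↭-trans
  (↭-reflexive (trans (cong (interval s) (+-comm 1 l)) (interval-++ s l 1)))
  (++-comm (interval s l) ((s + l) ∷ []))

interval-< : ∀ s l → All (_< s + l) (interval s l)
interval-< s zero = []
interval-< s (suc l) = m<m+n s z<s ∷
  subst (λ t → All (_< t) (interval (suc s) l)) (sym (+-suc s l)) (interval-< (suc s) l)

map-interval : ∀ {A : Set} (f : ℕ → A) s l →
               map f (interval s l) ≡ tabulate {n = l} (λ i → f (s + toℕ i))
map-interval f s zero = refl
map-interval f s (suc l) = cong₂ _∷_ (cong f (sym (+-identityʳ s)))
  (trans (map-interval f (suc s) l) (tabulate-cong (λ i → cong f (sym (+-suc s (toℕ i))))))

arc-sym : ∀ {V : Set} (t : Tree V) {u v} → (u , v) ∈ arcs t → (v , u) ∈ arcs t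
arc-sym t a = [ (λ l → proj₂ (link⇒arc t l)) , (λ l → proj₁ (link⇒arc t l)) ]′ (arc⇒link t a)

-- The root is the path vertex numbered `a`, the last one with a left tooth if there is any. From
-- there `leftComb` descends to 0, while `trunk` takes `r` steps to `a + r`, where the right teeth
-- begin. So the path has `m` = a + r + b + 1 vertices.
module Canonical (a b r : ℕ) where

  m n : ℕ
  m = a + b + suc r
  n = m + (a + b)

  spine≡ : spine n a b ≡ m
  spine≡ = m+n∸n≡m m (a + b)

  leftComb : ℕ → Tree ℕ
  leftComb zero    = leaf 0
  leftComb (suc q) = leaf (m + q) ▷ leftComb q ▷ leaf (suc q)

  rightComb : ℕ → ℕ → Tree ℕ
  rightComb zero    x = leaf x
  rightComb (suc q) x = leaf (a + b + suc x) ▷ rightComb q (suc x) ▷ leaf x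

  trunk : ℕ → ℕ → Tree ℕ
  trunk zero    x = rightComb b x
  trunk (suc j) x = trunk j (suc x) ▷ leaf x

  left-comb : ∀ q → Comb q (leftComb q)
  left-comb zero    = tip
  left-comb (suc q) = tooth (left-comb q)

  right-comb : ∀ q x → Comb q (rightComb q x)
  right-comb zero    x = tip
  right-comb (suc q) x = tooth (right-comb q (suc x))

  trunk-caterpillar : ∀ j x → Caterpillar j b (trunk j x)
  trunk-caterpillar zero    x = comb (right-comb b x)
  trunk-caterpillar (suc j) x = stem (trunk-caterpillar j (suc x))

  root-left : ∀ q → root (leftComb q) ≡ q
  root-left zero    = refl
  root-left (suc q) = refl

  root-right : ∀ q x → root (rightComb q x) ≡ x
  root-right zero    x = refl
  root-right (suc q) x = refl

  root-trunk : ∀ j x → root (trunk j x) ≡ x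
  root-trunk zero    x = root-right b x
  root-trunk (suc j) x = refl

  below-left : ∀ q → below (leftComb q) ↭ interval m q ++ interval 0 q
  below-left zero = ↭-refl
  below-left (suc q) rewrite root-left q | ++-identityʳ (below (leftComb q)) =
    ↭-trans (prep (m + q) (prep q (below-left q)))
      (↭-trans (prep (m + q) (↭-sym (shift q (interval m q) (interval 0 q))))
        (↭-sym (++⁺ (interval-∷ʳ m q) (interval-∷ʳ 0 q))))

  below-right : ∀ q x → below (rightComb q x) ↭
                interval (a + b + suc x) q ++ interval (suc x) q
  below-right zero x = ↭-refl
  below-right (suc q) x rewrite root-right q (suc x) | ++-identityʳ (below (rightComb q (suc x))) =
    prep (a + b + suc x) (↭-trans (prep (suc x) (subst (λ t → below (rightComb q (suc x)) ↭
        interval t q ++ interval (suc (suc x)) q) (+-suc (a + b) (suc x)) (below-right q (suc x))))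
      (↭-sym (shift (suc x) (interval (suc (a + b + suc x)) q) (interval (suc (suc x)) q))))

  below-trunk : ∀ j x → below (trunk j x) ↭ interval (suc x) j ++
                (interval (a + b + suc (x + j)) b ++ interval (suc (x + j)) b)
  below-trunk zero x rewrite +-identityʳ x = below-right b x
  below-trunk (suc j) x rewrite root-trunk j (suc x) | ++-identityʳ (below (trunk j (suc x)))
    | +-suc x j = prep (suc x) (below-trunk j (suc x))

  vertices-canonical : a ∷ below (leftComb a) ++ below (trunk r a) ↭ interval 0 n
  vertices-canonical = ↭-trans (prep a (++⁺ (below-left a) (below-trunk r a)))
    (↭-trans rearrange (↭-reflexive (sym join)))
    where
    A = interval 0 a
    B = interval (suc a) r
    D = interval (suc (a + r)) b
    L = interval m a
    R = interval (a + b + suc (a + r)) b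
    open CommutativeMonoidSolver (++-commutativeMonoid {A = ℕ}) using (prove; _⊕_; var)
    rearrange : (a ∷ []) ++ (L ++ A) ++ (B ++ (R ++ D)) ↭ A ++ ((a ∷ []) ++ (B ++ (D ++ (L ++ R))))
    rearrange = prove 6
      (var (# 0) ⊕ ((var (# 1) ⊕ var (# 2)) ⊕ (var (# 3) ⊕ (var (# 4) ⊕ var (# 5)))))
      (var (# 2) ⊕ (var (# 0) ⊕ (var (# 3) ⊕ (var (# 5) ⊕ (var (# 1) ⊕ var (# 4))))))
      ((a ∷ []) Vec.∷ L Vec.∷ A Vec.∷ B Vec.∷ R Vec.∷ D Vec.∷ Vec.[])
    join : interval 0 n ≡ A ++ ((a ∷ []) ++ (B ++ (D ++ (L ++ R))))
    join = begin
      interval 0 n                       ≡⟨ cong (interval 0) (lem a b r) ⟩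
      interval 0 (a + suc (r + (b + (a + b)))) ≡⟨ interval-++ 0 a _ ⟩
      A ++ interval a (suc (r + (b + (a + b)))) ≡⟨ cong (λ l → A ++ a ∷ l) (begin
        interval (suc a) (r + (b + (a + b)))  ≡⟨ interval-++ (suc a) r _ ⟩
        B ++ interval (suc (a + r)) (b + (a + b)) ≡⟨ cong (B ++_) (interval-++ (suc (a + r)) b _) ⟩
        B ++ (D ++ interval (suc (a + r) + b) (a + b))
          ≡⟨ cong (λ t → B ++ (D ++ interval t (a + b))) (lem₁ a b r) ⟩
        B ++ (D ++ interval m (a + b))  ≡⟨ cong (λ l → B ++ (D ++ l)) (interval-++ m a b) ⟩
        B ++ (D ++ (L ++ interval (m + a) b))
          ≡⟨ cong (λ t → B ++ (D ++ (L ++ interval t b))) (lem₂ a b r) ⟩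
        B ++ (D ++ (L ++ R)) ∎) ⟩
      A ++ ((a ∷ []) ++ (B ++ (D ++ (L ++ R)))) ∎
      where
      open ≡-Reasoning
      lem : ∀ a b r → a + b + suc r + (a + b) ≡ a + suc (r + (b + (a + b)))
      lem = solve-∀
      lem₁ : ∀ a b r → suc (a + r) + b ≡ a + b + suc r
      lem₁ = solve-∀
      lem₂ : ∀ a b r → a + b + suc r + a ≡ a + b + suc (a + r)
      lem₂ = solve-∀

  Joined : ℕ → ℕ → Set
  Joined x y = CEdge n a b x y ⊎ CEdge n a b y x

  path-edge : ∀ {x} → suc x < m → CEdge n a b x (suc x)
  path-edge {x} lt = inj₁ (refl , subst (suc x <_) (sym spine≡) lt)

  left-< : ∀ {q} → q < a → suc q < m
  left-< q<a = ≤-trans (s≤s q<a) (≤-trans (s≤s (m≤m+n a b))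
      (≤-trans (m≤m+n (suc (a + b)) r) (≤-reflexive (sym (+-suc (a + b) r)))))

  left-edge : ∀ {q} → q < a → CEdge n a b (suc q) (m + q)
  left-edge {q} q<a = inj₂ (inj₁
    (subst (λ s → suc q < s × s ≤ m + q × m + q < s + a × suc q + s ≡ suc (m + q)) (sym spine≡)
      (left-< q<a , m≤m+n m q , +-monoʳ-< m q<a , cong suc (+-comm q m))))

  m+a≡ : m + a ≡ a + b + suc (a + r)
  m+a≡ = lem a b r
    where
    lem : ∀ a b r → a + b + suc r + a ≡ a + b + suc (a + r)
    lem = solve-∀

  right-edge : ∀ {x} → a + r ≤ x → x < m → CEdge n a b x (a + b + suc x)
  right-edge {x} a+r≤x x<m = inj₂ (inj₂
    (subst (x <_) (sym spine≡) x<m ,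
     subst (λ s → s + a ≤ a + b + suc x) (sym spine≡)
       (≤-trans (≤-reflexive m+a≡) (+-monoʳ-≤ (a + b) (s≤s a+r≤x))) ,
     refl))

  arcs-left : ∀ q → q ≤ a → All (λ (x , y) → Joined x y) (arcs (leftComb q))
  arcs-left zero _ = []
  arcs-left (suc q) q<a rewrite root-left q | ++-identityʳ (arcs (leftComb q)) =
    inj₂ tooth′ ∷ inj₁ tooth′ ∷ inj₁ rung ∷ inj₂ rung ∷ arcs-left q (≤-trans (n≤1+n q) q<a)
    where
    tooth′ = left-edge q<a
    rung : CEdge n a b q (suc q)
    rung = path-edge (left-< q<a)

  arcs-right : ∀ q x → a + r ≤ x → suc (x + q) ≤ m →
               All (λ (x , y) → Joined x y) (arcs (rightComb q x))
  arcs-right zero x _ _ = []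
  arcs-right (suc q) x a+r≤x x<m
    rewrite root-right q (suc x) | ++-identityʳ (arcs (rightComb q (suc x))) =
    inj₂ tooth′ ∷ inj₁ tooth′ ∷ inj₂ rung ∷ inj₁ rung ∷
      arcs-right q (suc x) (≤-trans a+r≤x (n≤1+n x)) (subst (λ t → suc t ≤ m) (+-suc x q) x<m)
    where
    1+x<m : suc x < m
    1+x<m = ≤-trans (s≤s (s≤s (m≤m+n x q))) (subst (λ t → suc t ≤ m) (+-suc x q) x<m)
    tooth′ = right-edge a+r≤x (≤-trans (n≤1+n _) 1+x<m)
    rung = path-edge 1+x<m

  m≡ : suc (a + r + b) ≡ m
  m≡ = lem a b r
    where
    lem : ∀ a b r → suc (a + r + b) ≡ a + b + suc r
    lem = solve-∀

  arcs-trunk : ∀ j x → a ≤ x → x + j ≡ a + r →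
               All (λ (x , y) → Joined x y) (arcs (trunk j x))
  arcs-trunk zero x a≤x eq = arcs-right b x (≤-reflexive (trans (sym eq) (+-identityʳ x)))
    (≤-reflexive (trans (cong (λ t → suc (t + b)) (trans (sym (+-identityʳ x)) eq)) m≡))
  arcs-trunk (suc j) x a≤x eq rewrite root-trunk j (suc x) | ++-identityʳ (arcs (trunk j (suc x))) =
    inj₂ rung ∷ inj₁ rung ∷ arcs-trunk j (suc x) (≤-trans a≤x (n≤1+n x)) eq′
    where
    eq′ : suc x + j ≡ a + r
    eq′ = trans (sym (+-suc x j)) eq
    rung : CEdge n a b x (suc x)
    rung = path-edge (≤-trans (s≤s (≤-trans (m≤m+n (suc x) j) (≤-reflexive eq′)))
      (≤-trans (s≤s (m≤m+n (a + r) b)) (≤-reflexive m≡)))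

  arcs-sound : ∀ {x y} → (x , y) ∈ arcs (leftComb a) ++ arcs (trunk r a) → Joined x y
  arcs-sound e = All.lookup (All.++⁺ (arcs-left a ≤-refl) (arcs-trunk r a ≤-refl refl)) e

  left-path : ∀ {q x} → x < q → (x , suc x) ∈ arcs (leftComb q)
  left-path {suc q} {x} x<q with m<1+n⇒m<n∨m≡n x<q
  ... | inj₁ lt = there (there (there (there (∈-++⁺ˡ (left-path lt)))))
  ... | inj₂ refl = there (there (here (cong (_, suc q) (sym (root-left q)))))

  left-tooth : ∀ {q i} → i < q → (suc i , m + i) ∈ arcs (leftComb q)
  left-tooth {suc q} {i} i<q with m<1+n⇒m<n∨m≡n i<q
  ... | inj₁ lt = there (there (there (there (∈-++⁺ˡ (left-tooth lt)))))
  ... | inj₂ refl = there (here refl)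

  right-path : ∀ {q i} x → i < q → (x + i , suc (x + i)) ∈ arcs (rightComb q x)
  right-path {suc q} {zero} x _ rewrite +-identityʳ x =
    there (there (there (here (cong (x ,_) (sym (root-right q (suc x)))))))
  right-path {suc q} {suc i} x (s≤s lt) rewrite +-suc x i =
    there (there (there (there (∈-++⁺ˡ (right-path (suc x) lt)))))

  right-tooth : ∀ {q i} x → i < q → (x + i , a + b + suc (x + i)) ∈ arcs (rightComb q x)
  right-tooth {suc q} {zero} x _ rewrite +-identityʳ x = there (here refl)
  right-tooth {suc q} {suc i} x (s≤s lt) rewrite +-suc x i =
    there (there (there (there (∈-++⁺ˡ (right-tooth (suc x) lt)))))

  trunk-path : ∀ {j i} x → i < j → (x + i , suc (x + i)) ∈ arcs (trunk j x)
  trunk-path {suc j} {zero} x _ rewrite +-identityʳ x =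
    there (here (cong (x ,_) (sym (root-trunk j (suc x)))))
  trunk-path {suc j} {suc i} x (s≤s lt) rewrite +-suc x i =
    there (there (∈-++⁺ˡ (trunk-path (suc x) lt)))

  trunk-right : ∀ j x {e} → e ∈ arcs (rightComb b (x + j)) → e ∈ arcs (trunk j x)
  trunk-right zero x e rewrite +-identityʳ x = e
  trunk-right (suc j) x e rewrite +-suc x j = there (there (∈-++⁺ˡ (trunk-right j (suc x) e)))

  arcs-complete : ∀ {x y} → y < n → CEdge n a b x y → (x , y) ∈ arcs (leftComb a) ++ arcs (trunk r a)
  arcs-complete {x} _ (inj₁ (refl , lt)) with x <? a
  ... | yes x<a = ∈-++⁺ˡ (left-path x<a)
  ... | no x≮a with i , refl ← m≤n⇒∃[o]m+o≡n (≮⇒≥ x≮a) with i <? r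
  ...   | yes i<r = ∈-++⁺ʳ (arcs (leftComb a)) (trunk-path a i<r)
  ...   | no i≮r with j , refl ← m≤n⇒∃[o]m+o≡n (≮⇒≥ i≮r) =
    ∈-++⁺ʳ (arcs (leftComb a)) (trunk-right r a
      (subst (λ t → (t , suc t) ∈ arcs (rightComb b (a + r))) (+-assoc a r j)
        (right-path (a + r) (+-cancelˡ-< (a + r) j b
          (s<s⁻¹ (subst₂ _<_ (cong suc (sym (+-assoc a r j))) (trans spine≡ (sym m≡)) lt))))))
  arcs-complete {suc x} _ (inj₂ (inj₁ (_ , s≤y , y<s+a , eq)))
    with refl ← trans (cong (_+ x) (sym spine≡)) (trans (+-comm _ x) (suc-injective eq)) =
    ∈-++⁺ˡ (left-tooth (+-cancelˡ-< m x a (subst (λ s → m + x < s + a) spine≡ y<s+a)))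
  arcs-complete {zero} _ (inj₂ (inj₁ (_ , s≤y , y<s+a , eq))) =
    contradiction s≤y (<⇒≱ (≤-reflexive (sym eq)))
  arcs-complete {x} y<n (inj₂ (inj₂ (x<s , s+a≤y , refl)))
    with i , refl ← m≤n⇒∃[o]m+o≡n (s≤s⁻¹ (+-cancelˡ-≤ (a + b) (suc (a + r)) (suc x)
      (≤-trans (≤-reflexive (sym m+a≡)) (subst (λ s → s + a ≤ a + b + suc x) spine≡ s+a≤y)))) =
    ∈-++⁺ʳ (arcs (leftComb a)) (trunk-right r a (right-tooth (a + r)
      (+-cancelˡ-< (a + r) i b (s<s⁻¹ (subst (suc (a + r + i) <_) (sym m≡)
        (+-cancelˡ-< (a + b) _ m (subst (a + b + suc (a + r + i) <_) (+-comm m (a + b)) y<n)))))))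

  instance
    n≢0 : NonZero n
    n≢0 = >-nonZero (≤-trans (s≤s z≤n) (≤-trans (≤-reflexive m≡) (m≤m+n m (a + b))))

  -- Reduction modulo `n` makes the labelling total, so that trees over ℕ can be mapped without
  -- carrying bounds along. It is applied only to numbers below `n`.
  label : ℕ → Fin n
  label x = x mod n

  toℕ-label : ∀ {x} → x < n → toℕ (label x) ≡ x
  toℕ-label {x} x<n = trans (Fin.toℕ-fromℕ< (m%n<n x n)) (m<n⇒m%n≡m x<n)

  label-toℕ : ∀ v → label (toℕ v) ≡ v
  label-toℕ v = Fin.toℕ-injective (toℕ-label (Fin.toℕ<n v))

  labelled : map label (interval 0 n) ≡ allFin n
  labelled = trans (map-interval label 0 n) (tabulate-cong label-toℕ)

  left right : Tree (Fin n)
  left  = mapTree label (leftComb a)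
  right = mapTree label (trunk r a)

  left-caterpillar : Caterpillar 0 a left
  left-caterpillar = caterpillar-map label (comb (left-comb a))

  right-caterpillar : Caterpillar r b right
  right-caterpillar = caterpillar-map label (trunk-caterpillar r a)

  arcs-labelled : arcs left ++ arcs right ≡
                  map (Product.map label label) (arcs (leftComb a) ++ arcs (trunk r a))
  arcs-labelled = trans (cong₂ _++_ (arcs-map label (leftComb a)) (arcs-map label (trunk r a)))
    (sym (map-++ (Product.map label label) (arcs (leftComb a)) (arcs (trunk r a))))

  vertex-< : ∀ {x} → x ∈ a ∷ below (leftComb a) ++ below (trunk r a) → x < n
  vertex-< x∈ = All.lookup (interval-< 0 n) (∈-resp-↭ vertices-canonical x∈)

  arc-< : ∀ {x y} → (x , y) ∈ arcs (leftComb a) ++ arcs (trunk r a) → x < n × y < n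
  arc-< e with ∈-++⁻ (arcs (leftComb a)) e
  ... | inj₁ e′ with x∈ , y∈ ← arc-ends (leftComb a) e′ = vertex-< (in-left x∈) , vertex-< (in-left y∈)
    where
    in-left : ∀ {x} → x ∈ vertices (leftComb a) → x ∈ a ∷ below (leftComb a) ++ below (trunk r a)
    in-left (here eq) = here (trans eq (root-left a))
    in-left (there x∈) = there (∈-++⁺ˡ x∈)
  ... | inj₂ e′ with x∈ , y∈ ← arc-ends (trunk r a) e′ = vertex-< (in-right x∈) , vertex-< (in-right y∈)
    where
    in-right : ∀ {x} → x ∈ vertices (trunk r a) → x ∈ a ∷ below (leftComb a) ++ below (trunk r a)
    in-right (here eq) = here (trans eq (root-trunk r a))
    in-right (there x∈) = there (∈-++⁺ʳ (below (leftComb a)) x∈)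

  arc-flip : ∀ {V : Set} (X Y : Tree V) {u v} → (u , v) ∈ arcs X ++ arcs Y → (v , u) ∈ arcs X ++ arcs Y
  arc-flip X Y e with ∈-++⁻ (arcs X) e
  ... | inj₁ e′ = ∈-++⁺ˡ (arc-sym X e′)
  ... | inj₂ e′ = ∈-++⁺ʳ (arcs X) (arc-sym Y e′)

  split : Split (C n a b) left right
  split = mkSplit roots exhaust adj⇒arc arc⇒adj
    where
    roots : root left ≡ root right
    roots = trans (root-map label (leftComb a))
      (trans (cong label (trans (root-left a) (sym (root-trunk r a))))
      (sym (root-map label (trunk r a))))
    exhaust : root left ∷ below left ++ below right ↭ allFin n
    exhaust = ↭-trans (↭-reflexive (cong₂ _∷_
        (trans (root-map label (leftComb a)) (cong label (root-left a)))
        (trans (cong₂ _++_ (below-map label (leftComb a)) (below-map label (trunk r a)))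
               (sym (map-++ label (below (leftComb a)) (below (trunk r a)))))))
      (↭-trans (↭-map⁺ label vertices-canonical) (↭-reflexive labelled))
    complete : ∀ {u v} → Adj (C n a b) u v → (toℕ u , toℕ v) ∈ arcs (leftComb a) ++ arcs (trunk r a)
    complete {u} {v} (inj₁ e) = arcs-complete (Fin.toℕ<n v) e
    complete {u} {v} (inj₂ e) = arc-flip (leftComb a) (trunk r a) (arcs-complete (Fin.toℕ<n u) e)
    adj⇒arc : ∀ {u v} → Adj (C n a b) u v → (u , v) ∈ arcs left ++ arcs right
    adj⇒arc {u} {v} uv = subst₂ _∈_ (cong₂ _,_ (label-toℕ u) (label-toℕ v)) (sym arcs-labelled)
      (∈-map⁺ (Product.map label label) (complete uv))
    arc⇒adj : ∀ {u v} → (u , v) ∈ arcs left ++ arcs right → Adj (C n a b) u v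
    arc⇒adj e with (x , y) , e′ , refl ← ∈-map⁻ (Product.map label label) (subst (_ ∈_) arcs-labelled e)
      with x<n , y<n ← arc-< e′ =
      subst₂ Joined (sym (toℕ-label x<n)) (sym (toℕ-label y<n)) (arcs-sound e′)

-- Comparison with `C n a b`

⌈/2⌉-cases : ∀ m → ⌈ m /2⌉ ≡ ⌊ m /2⌋ ⊎ ⌈ m /2⌉ ≡ suc ⌊ m /2⌋
⌈/2⌉-cases zero = inj₁ refl
⌈/2⌉-cases (suc zero) = inj₂ refl
⌈/2⌉-cases (suc (suc m)) with ⌈/2⌉-cases m
... | inj₁ eq = inj₁ (cong suc eq)
... | inj₂ eq = inj₂ (cong suc eq)

-- What is dropped is the square of the difference of `x` and `y`. It is at most 1 at a balanced
-- split, and `quarter` makes up for it.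
sum-of-squares-≥ : ∀ x y → (x + y) * (x + y) + 2 * (x + y) ≤ 2 * (x * suc x) + 2 * (y * suc y)
sum-of-squares-≥ x y with ≤-total x y
... | inj₁ x≤y with g , refl ← m≤n⇒∃[o]m+o≡n x≤y = m+n≤o⇒m≤o _ (≤-reflexive (lem x g))
  where
  lem : ∀ x g → (x + (x + g)) * (x + (x + g)) + 2 * (x + (x + g)) + g * g ≡
                2 * (x * suc x) + 2 * ((x + g) * suc (x + g))
  lem = solve-∀
... | inj₂ y≤x with g , refl ← m≤n⇒∃[o]m+o≡n y≤x = m+n≤o⇒m≤o _ (≤-reflexive (lem y g))
  where
  lem : ∀ y g → (y + g + y) * (y + g + y) + 2 * (y + g + y) + g * g ≡
                2 * ((y + g) * suc (y + g)) + 2 * (y * suc y)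
  lem = solve-∀

-- The number of vertices by which to slide the root of the canonical split to
-- make both sides at most half of the tree.
halves : ∀ {a b} → a ≡ b ⊎ a ≡ suc b → ∀ d → ∃₂ λ l j → l + j ≡ suc d ×
         2 * a + (l + 0) ≤ suc (2 * b + j) × 2 * b + j ≤ suc (2 * a + (l + 0))
halves {a} (inj₁ refl) d = ⌊ suc d /2⌋ , ⌈ suc d /2⌉ , ⌊n/2⌋+⌈n/2⌉≡n (suc d) ,
  ≤-trans (+-monoʳ-≤ (2 * a) (≤-trans (≤-reflexive (+-identityʳ _)) (⌊n/2⌋≤⌈n/2⌉ (suc d)))) (n≤1+n _) ,
  ≤-trans (+-monoʳ-≤ (2 * a) (up (⌈/2⌉-cases (suc d)))) (≤-reflexive (+-suc (2 * a) _))
  where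
  up : ∀ {x y} → x ≡ y ⊎ x ≡ suc y → x ≤ suc (y + 0)
  up (inj₁ refl) = ≤-trans (n≤1+n _) (≤-reflexive (cong suc (sym (+-identityʳ _))))
  up (inj₂ refl) = ≤-reflexive (cong suc (sym (+-identityʳ _)))
-- The left comb has two vertices more than the right one. One vertex of the stem goes to the right
-- in return, and the other `d` are shared out evenly.
halves {b = b} (inj₂ refl) d = ⌊ d /2⌋ , suc ⌈ d /2⌉ ,
  trans (+-suc _ _) (cong suc (⌊n/2⌋+⌈n/2⌉≡n d)) ,
  ≤-trans (≤-reflexive (lem b ⌊ d /2⌋))
    (≤-trans (+-monoʳ-≤ (2 * b) (s≤s (s≤s (⌊n/2⌋≤⌈n/2⌉ d)))) (≤-reflexive (+-suc (2 * b) _))) ,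
  ≤-trans (+-monoʳ-≤ (2 * b) (s≤s (up (⌈/2⌉-cases d))))
    (≤-trans (n≤1+n _) (≤-reflexive (cong suc (sym (lem b ⌊ d /2⌋)))))
  where
  up : ∀ {x y} → x ≡ y ⊎ x ≡ suc y → x ≤ suc y
  up (inj₁ refl) = n≤1+n _
  up (inj₂ refl) = ≤-refl
  lem : ∀ b l → 2 * suc b + (l + 0) ≡ 2 * b + (2 + l)
  lem = solve-∀

module _ {n} {G : SimpleGraph n} where

  half : ∀ {x y} → suc (x + y) ≡ n → x ≤ suc y → 2 * x ≤ n
  half {x} {y} eq le = begin
    2 * x       ≡⟨ cong (x +_) (+-identityʳ x) ⟩
    x + x       ≤⟨ +-monoʳ-≤ x le ⟩
    x + suc y   ≡⟨ +-suc x y ⟩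
    suc (x + y) ≡⟨ eq ⟩
    n           ∎
    where open ≤-Reasoning

  depths-≥ : (conn : Connected G) → ∀ {X Y} → Split G X Y → ∀ {M D} → Mo G conn ≤ M →
    M + 2 * D ≡ n * pred n → D ≤ depths X + depths Y
  depths-≥ conn {X} {Y} s {M} {D} Mo≤ eq = *-cancelˡ-≤ {D} {depths X + depths Y} 2
    (+-cancelˡ-≤ M (2 * D) (2 * (depths X + depths Y)) (begin
      M + 2 * D                              ≡⟨ eq ⟩
      n * pred n                             ≡⟨ cong (λ m → n * pred m) (split-order s) ⟨
      n * (descendants X + descendants Y)    ≤⟨ Mo-≥ conn s ⟩
      Mo G conn + 2 * (depths X + depths Y)  ≤⟨ +-monoˡ-≤ (2 * (depths X + depths Y)) Mo≤ ⟩
      M + 2 * (depths X + depths Y)          ∎))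
    where open ≤-Reasoning

  Mo-balanced : (conn : Connected G) → ∀ {i j a b X Y} →
    Caterpillar i a X → Caterpillar j b Y → Split G X Y →
    2 * a + i ≤ suc (2 * b + j) → 2 * b + j ≤ suc (2 * a + i) →
    Mo G conn + 2 * (depths X + depths Y) ≡ n * pred n ×
    pred n * pred n + 2 * pred n ≤ 4 * (depths X + depths Y) + 4 * (a * a + b * b)
  Mo-balanced conn {a = a} {b} {X} {Y} cX cY s le le′ =
    trans (Mo-≡ conn s (half (split-order s) X≤)
                       (half (trans (cong suc (+-comm _ (descendants X))) (split-order s)) Y≤))
          (cong (n *_) (cong pred (split-order s))) ,
    subst (λ N → N * N + 2 * N ≤ 4 * (depths X + depths Y) + 4 * (a * a + b * b))
      (cong pred (split-order s))
      (≤-trans (sum-of-squares-≥ (descendants X) (descendants Y)) (≤-reflexive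
        (trans (cong₂ (λ u w → 2 * u + 2 * w) (sym (caterpillar-depths cX)) (sym (caterpillar-depths cY)))
               (lem (depths X) (depths Y) (a * a) (b * b)))))
    where
    X≤ = subst₂ (λ x y → x ≤ suc y) (sym (caterpillar-descendants cX))
                                    (sym (caterpillar-descendants cY)) le
    Y≤ = subst₂ (λ x y → x ≤ suc y) (sym (caterpillar-descendants cY))
                                    (sym (caterpillar-descendants cX)) le′
    lem : ∀ D E A B → 2 * (2 * (D + A)) + 2 * (2 * (E + B)) ≡ 4 * (D + E) + 4 * (A + B)
    lem = solve-∀

module Extremal {a b : ℕ} (near : a ≡ b ⊎ a ≡ suc b) (d : ℕ) where

  open Canonical a b (suc d) using (n)
  module S = Canonical a b (suc d)

  C∈𝒪 : 𝒪 n (suc (a + b)) (C n a b)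
  C∈𝒪 = record
    { isTree  = split⇒tree S.split
    ; oddness = trans (count-odd S.split) (cong (2 *_) (begin
        -- `odd S.right` computes to `true`: the trunk has length `suc d`, so the root has exactly
        -- one child on that side.
        twigs S.left + twigs S.right + ⟦ odd S.left ∨ true ⟧
          ≡⟨ cong₂ (λ i j → i + j + ⟦ odd S.left ∨ true ⟧)
               (caterpillar-twigs S.left-caterpillar) (caterpillar-twigs S.right-caterpillar) ⟩
        a + b + ⟦ odd S.left ∨ true ⟧  ≡⟨ cong (λ o → a + b + ⟦ o ⟧) (∨-zeroʳ (odd S.left)) ⟩
        a + b + 1                      ≡⟨ +-comm (a + b) 1 ⟩
        suc (a + b)                    ∎))
    }
    where
    open ≡-Reasoning

  -- `S.split` need not be balanced. Its root is slid along the trunk until neither side exceeds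
  -- half of the vertices, where `Mo-≡` gives the index exactly.
  Mo-C : ∃ λ D → Mo (C n a b) (𝒪.connected C∈𝒪) + 2 * D ≡ n * pred n ×
    pred n * pred n + 2 * pred n ≤ 4 * D + 4 * (a * a + b * b)
  Mo-C =
    let l , j , l+j , le , le′ = halves near d
        X , Y , cX , cY , s = slide l S.left-caterpillar
          (subst (λ r → Caterpillar r b S.right) (sym l+j) S.right-caterpillar) S.split
    in depths X + depths Y , Mo-balanced (𝒪.connected C∈𝒪) cX cY s le le′

  module _ (T : SimpleGraph n) (T∈𝒪 : 𝒪 n (suc (a + b)) T)
    (min : Mo T (𝒪.connected T∈𝒪) ≤ Mo (C n a b) (𝒪.connected C∈𝒪)) where

    twigs≥ : ∀ {X Y} → Split T X Y → a + b ≤ twigs X + twigs Y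
    twigs≥ {X} {Y} s = s≤s⁻¹ (≤-trans
      (≤-reflexive (*-cancelˡ-≡ _ _ 2 (trans (sym (𝒪.oddness T∈𝒪)) (count-odd s))))
      (≤-trans (+-monoʳ-≤ (twigs X + twigs Y) (⟦⟧≤1 (odd X ∨ odd Y))) (≤-reflexive (+-comm _ 1))))
      where
      ⟦⟧≤1 : ∀ o → ⟦ o ⟧ ≤ 1
      ⟦⟧≤1 false = z≤n
      ⟦⟧≤1 true  = ≤-refl
    deep : ∀ {X Y} → Split T X Y →
      (descendants X + descendants Y) * (descendants X + descendants Y)
        + 2 * (descendants X + descendants Y) ≤
      4 * (depths X + depths Y) + 4 * (a * a + b * b)
    deep {X} {Y} s = let D , MoC , large = Mo-C in
      subst (λ N → N * N + 2 * N ≤ 4 * (depths X + depths Y) + 4 * (a * a + b * b))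
        (sym (cong pred (split-order s)))
        (≤-trans large (+-monoˡ-≤ (4 * (a * a + b * b))
          (*-monoʳ-≤ 4 {D} {depths X + depths Y} (depths-≥ (𝒪.connected T∈𝒪) s min MoC))))

    -- The combs have `2 * a` and `2 * b` descendants, so the order `n` determines the length of the
    -- stem.
    r≡ : ∀ {r X Y} → Caterpillar 0 a X → Caterpillar r b Y → Split T X Y → r ≡ suc d
    r≡ {r} {X} {Y} cX cY s = +-cancelˡ-≡ (2 * b) r (suc d) (+-cancelˡ-≡ (2 * a + 0) _ _ (begin
      2 * a + 0 + (2 * b + r)       ≡⟨ cong₂ _+_ (caterpillar-descendants cX) (caterpillar-descendants cY) ⟨
      descendants X + descendants Y ≡⟨ suc-injective (trans (split-order s) (sym (split-order S.split))) ⟩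
      descendants S.left + descendants S.right
        ≡⟨ cong₂ _+_ (caterpillar-descendants S.left-caterpillar) (caterpillar-descendants S.right-caterpillar) ⟩
      2 * a + 0 + (2 * b + suc d) ∎))
      where open ≡-Reasoning

    minimal⇒C : T ≅ C n a b
    minimal⇒C =
      let _ , _ , s = tree⇒split (𝒪.isTree T∈𝒪) (S.label 0)
          r , X , Y , cX , cY , s′ = Descent.canonical near twigs≥ deep s
      in split-≅ (caterpillar-shape cX S.left-caterpillar)
           (caterpillar-shape (subst (λ r → Caterpillar r b Y) (r≡ cX cY s′) cY) S.right-caterpillar)
           s′ S.split

extremal : ∀ {n k a b d} → a ≡ b ⊎ a ≡ suc b → k ≡ suc (a + b) → n ≡ Canonical.n a b (suc d) →
  (T : SimpleGraph n) (T∈𝒪 : 𝒪 n k T) →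
  ((T′ : SimpleGraph n) (T′∈𝒪 : 𝒪 n k T′) → Mo T (𝒪.connected T∈𝒪) ≤ Mo T′ (𝒪.connected T′∈𝒪)) →
  T ≅ C n a b
extremal {d = d} near refl refl T T∈𝒪 min =
  Extremal.minimal⇒C near d T T∈𝒪 (min _ (Extremal.C∈𝒪 near d))

theorem3p2 : (n k : ℕ) → 1 ≤ k → k ≤ ⌊ n /2⌋ →
    (T : SimpleGraph n) (T∈𝒪 : 𝒪 n k T) →
    ((T′ : SimpleGraph n) (T′∈𝒪 : 𝒪 n k T′) →
    Mo T (𝒪.connected T∈𝒪) ≤ Mo T′ (𝒪.connected T′∈𝒪)) →
    T ≅ C n ⌈ k ∸ 1 /2⌉ ⌊ k ∸ 1 /2⌋
theorem3p2 n (suc k) _ k≤ T T∈𝒪 min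
  -- Here `n` is `2 * suc k + d`. The combs and the root account for `2 * k + 1` vertices and leave
  -- `suc d` for the stem, which is therefore never empty.
  with d , eq ← m≤n⇒∃[o]m+o≡n (≤-trans (+-mono-≤ k≤ (≤-trans k≤ (⌊n/2⌋≤⌈n/2⌉ n)))
                                       (≤-reflexive (⌊n/2⌋+⌈n/2⌉≡n n)))
  = extremal {a = a} {b} {d} (⌈/2⌉-cases k) (cong suc (sym a+b)) n≡ T T∈𝒪 min
  where
  a = ⌈ k /2⌉
  b = ⌊ k /2⌋
  a+b : a + b ≡ k
  a+b = trans (+-comm a b) (⌊n/2⌋+⌈n/2⌉≡n k)
  n≡ : n ≡ a + b + suc (suc d) + (a + b)
  n≡ = trans (sym eq) (trans (lem k d) (cong (λ m → m + suc (suc d) + m) (sym a+b)))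
    where
    lem : ∀ k d → suc k + suc k + d ≡ k + suc (suc d) + k
    lem = solve-∀
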